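{- For any fixed integer $k\ge 4$, as $n\to\infty$, $$f_k(n,k+2,3)=e^{O\left(\sqrt{\log_{(k-1)} n}\right)}=(\log_{(k-2)} n)^{o(1)}.$$
   Context: $K_n^{(k)}$ denotes the complete $k$-uniform hypergraph on $n$ vertices. For positive integers $p,q$, a $(p,q)$-coloring of $K_n^{(k)}$ is an edge-coloring of $K_n^{(k)}$ in which every copy of $K_p^{(k)}$ (i.e. the set of all $k$-subsets of any $p$ vertices) receives at least $q$ distinct colors. $f_k(n,p,q)$ is the minimum number of colors in a $(p,q)$-coloring of $K_n^{(k)}$. Iterated logarithms: $\log_{(0)}x=x$ and $\log_{(i+1)}x=\log\log_{(i)}x$ for $i\ge 0$. The asymptotic notation is for $k$ fixed and $n\to\infty$ (implied constants may depend on $k$); the first equality is an upper bound: there is a constant $C=C(k)$ with $f_k(n,k+2,3)\le e^{C\sqrt{\log_{(k-1)}n}}$ for all sufficiently large $n$. -}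

module Defs where

open import Algebra.Definitions.RawSemiring using (_^_)
open import Data.Fin using (Fin)
open import Data.Fin.Subset using (Subset; _⊆_; ∣_∣)
open import Data.Integer using (+_)
open import Data.Nat as ℕ using (ℕ; zero; suc)
open import Data.Product using (Σ-syntax; ∃-syntax; _×_; proj₁)
open import Data.Rational using (ℚ; 0ℚ; 1ℚ; _+_; _*_; _/_; _≤_; _<_; +-*-rawSemiring)
open import Function.Definitions using (Injective)
open import Level using (0ℓ)
import Relation.Unary as U
open import Relation.Binary.PropositionalEquality using (_≡_)

Eventually : (ℕ → Set) → Set
Eventually P = ∃[ N ] ∀ n → N ℕ.≤ n → P n

-- The vertex set is Fin n.
Edge : ℕ → ℕ → Set
Edge n k = Σ[ e ∈ Subset n ] ∣ e ∣ ≡ k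

-- Colors need not all be used; the least m for which a suitable coloring
-- exists is the same whether or not surjectivity is demanded.
Coloring : ℕ → ℕ → ℕ → Set
Coloring n k m = Edge n k → Fin m

Is[_,_]-Coloring : ∀ p q {n k m} → Coloring n k m → Set
Is[ p , q ]-Coloring {n} {k} {m} col =
  ∀ (S : Subset n) → ∣ S ∣ ≡ p →
  Σ[ c ∈ (Fin q → Fin m) ]
    Injective _≡_ _≡_ c ×
    (∀ i → Σ[ e ∈ Edge n k ] proj₁ e ⊆ S × col e ≡ c i)

-- IsF k n p q m says that f_k(n,p,q) = m.
record IsF (k n p q m : ℕ) : Set where
  field
    attained : Σ[ col ∈ Coloring n k m ] Is[ p , q ]-Coloring col
    minimal  : ∀ m′ (col : Coloring n k m′) → Is[ p , q ]-Coloring col → m ℕ.≤ m′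

-- A real number x is given by the set of rationals q with x < q.  Every
-- function below is nondecreasing, so upper cuts suffice to define it.
-- The empty cut is +∞ and the full cut is -∞.
ℝᵘ : Set₁
ℝᵘ = U.Pred ℚ 0ℓ

infix 4 _≼_
_≼_ : ℝᵘ → ℝᵘ → Set
x ≼ y = y U.⊆ x

fromℕ : ℕ → ℝᵘ
fromℕ m q = (+ m) / 1 < q

-- Scaling; only meaningful for a positive factor.
infixr 7 _·_
_·_ : ℚ → ℝᵘ → ℝᵘ
(a · x) q = ∃[ r ] x r × a * r ≤ q

-- (1 + r/N)^N with N = suc n; it converges to e^r.
expSeq : ℚ → ℕ → ℚ
expSeq r n = _^_ +-*-rawSemiring (1ℚ + r * ((+ 1) / suc n)) (suc n)

-- Strict comparison of a rational q with lim expSeq r, for rational r: an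
-- intermediate s makes the eventual weak bounds equivalent to strictness.
e^_<_ : ℚ → ℚ → Set
e^ r < q = ∃[ s ] s < q × Eventually (λ n → expSeq r n ≤ s)

_<e^_ : ℚ → ℚ → Set
q <e^ r = ∃[ s ] q < s × Eventually (λ n → s ≤ expSeq r n)

-- e^x < q iff e^r < q for some rational r > x.
exp : ℝᵘ → ℝᵘ
exp x q = ∃[ r ] x r × e^ r < q

-- For x > 0: log x < q iff x < e^q iff r < e^q for some rational r > x.
-- For x ≤ 0 this gives -∞.
log : ℝᵘ → ℝᵘ
log x q = ∃[ r ] x r × r <e^ q

-- For x < 0 this gives 0.
√ : ℝᵘ → ℝᵘ
√ x q = 0ℚ < q × x (q * q)

-- x ^ʳ a is x^a for x > 0 and rational a > 0.
infix 8 _^ʳ_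
_^ʳ_ : ℝᵘ → ℚ → ℝᵘ
x ^ʳ a = exp (a · log x)

log₍_₎ : ℕ → ℝᵘ → ℝᵘ
log₍ zero ₎  x = x
log₍ suc i ₎ x = log (log₍ i ₎ x)

{-# OPTIONS --safe #-}
-- A graph colouring on [b]ᵗ with b = 2ᵗ that is (4,3) (Mubayi's) is stepped up
-- k - 2 times from N to 2ᴺ vertices. A set of bit strings of length N is a
-- binary tree whose branchings sit on levels below N. A k + 1-set is coloured
-- by the shape of its tree, read off down to the first branching that has at
-- least two points on both sides (a fork), together with the colour of the
-- k-set of its levels. In a set S of k + 3 strings without a fork, the level
-- sets give three colours by induction. If S has a fork and k ≥ 3, the shapes
-- alone give three colours, except that when one side of the fork has two
-- points and the other is a caterpillar, one also needs that k + 1 levels see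
-- two colours; this is carried along in the induction. For k = 2 a five-set with
-- a fork needs more: the graph colouring has no x, y, z, w with c(xy) = c(xz)
-- and c(yz) = c(xw). Each step multiplies the number of colours by a constant,
-- so 2^{O(t)} colours suffice for a tower of k - 1 twos topped by t².
--
-- An upper bound q of exp (C · √ L), L the iterated logarithm of n, comes with a
-- chain of rational upper bounds n < e^..., so all logarithms are eliminated in
-- favour of inequalities between n and towers.
module Submission where

open import Defs

-- Replacing exponentials and logarithms by towers of twos

module Asymptotics where

  open import Algebra.Definitions.RawSemiring using (_^_)
  open import Data.Integer as ℤ using (-[1+_])
  import Data.Integer.Properties as ℤₚ
  open import Data.Nat as ℕ using (ℕ; zero; suc; z≤n; s≤s)
  import Data.Nat.Solver as ℕ-Solver
  import Data.Nat.Properties as ℕₚ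
  open import Data.Nat.Coprimality as Coprime using (1-coprimeTo)
  open import Data.Empty using (⊥-elim)
  open import Data.Product using (_×_; _,_; ∃-syntax)
  open import Data.Rational
  open import Data.Rational.Properties
  open import Data.Rational.Solver using (module +-*-Solver)
  open import Algebra.Bundles using (CommutativeRing)
  import Algebra.Properties.Semiring.Exp (CommutativeRing.semiring +-*-commutativeRing) as Exp
  open import Algebra.Properties.Group +-0-group using (⁻¹-involutive)
  open import Relation.Nullary using (yes; no)
  open import Relation.Binary.PropositionalEquality hiding ([_])

  -- Doubling instead of `2 ^ N` makes a bit vector of length `cube (suc N)` split definitionally
  -- into two halves of length `cube N`.
  cube : ℕ → ℕ
  cube zero    = 1
  cube (suc N) = cube N ℕ.+ cube N

  -- The innermost exponential is peeled off first, in the order in which stepping up proceeds from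
  -- the smallest vertex set.
  tower : ℕ → ℕ → ℕ
  tower zero    x = x
  tower (suc j) x = tower j (cube x)

  cube≡2^ : ∀ n → cube n ≡ 2 ℕ.^ n
  cube≡2^ zero    = refl
  cube≡2^ (suc n) = cong₂ ℕ._+_ (cube≡2^ n) (trans (cube≡2^ n) (sym (ℕₚ.+-identityʳ _)))

  -- Rational arithmetic and powers

  infixr 8 _^ᵠ_
  _^ᵠ_ : ℚ → ℕ → ℚ
  _^ᵠ_ = _^_ +-*-rawSemiring

  ι : ℕ → ℚ
  ι m = ℤ.+ m / 1

  -- The division `_/_` goes through a gcd that is stuck on a variable; rewriting to an explicit
  -- fraction lets sums, products and comparisons compute.
  ι-mkℚ : ∀ m → ι m ≡ mkℚ (ℤ.+ m) 0 (Coprime.sym (1-coprimeTo m))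
  ι-mkℚ m = normalize-coprime _

  ι-+ : ∀ m n → ι (m ℕ.+ n) ≡ ι m + ι n
  ι-+ m n rewrite ι-mkℚ m | ι-mkℚ n =
    cong (_/ 1) (sym (cong₂ ℤ._+_ (ℤₚ.*-identityʳ (ℤ.+ m)) (ℤₚ.*-identityʳ (ℤ.+ n))))

  ι-* : ∀ m n → ι (m ℕ.* n) ≡ ι m * ι n
  ι-* m n rewrite ι-mkℚ m | ι-mkℚ n = cong (_/ 1) (ℤₚ.pos-* m n)

  ι-mono : ∀ {m n} → m ℕ.≤ n → ι m ≤ ι n
  ι-mono {m} {n} m≤n rewrite ι-mkℚ m | ι-mkℚ n = *≤* (ℤₚ.*-monoʳ-≤-nonNeg (ℤ.+ 1) (ℤ.+≤+ m≤n))

  ι-cancel-< : ∀ {m n} → ι m < ι n → m ℕ.< n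
  ι-cancel-< {m} {n} m<n rewrite ι-mkℚ m | ι-mkℚ n = ℤₚ.drop‿+<+ (ℤₚ.*-cancelʳ-<-nonNeg (ℤ.+ 1) (drop-*<* m<n))

  ι-^ : ∀ m n → ι (m ℕ.^ n) ≡ ι m ^ᵠ n
  ι-^ m zero    = refl
  ι-^ m (suc n) = trans (ι-* m (m ℕ.^ n)) (cong (ι m *_) (ι-^ m n))

  0≤ι : ∀ m → 0ℚ ≤ ι m
  0≤ι m = ι-mono {0} {m} z≤n

  recip : ℕ → ℚ
  recip n = (ℤ.+ 1) / suc n

  recip-mkℚ : ∀ n → recip n ≡ mkℚ (ℤ.+ 1) n (1-coprimeTo (suc n))
  recip-mkℚ n = normalize-coprime _

  ι*recip : ∀ n → ι (suc n) * recip n ≡ 1ℚ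
  ι*recip n rewrite ι-mkℚ (suc n) | recip-mkℚ n =
    *-inverseʳ (mkℚ (ℤ.+ suc n) 0 (Coprime.sym (1-coprimeTo (suc n))))

  0≤recip : ∀ n → 0ℚ ≤ recip n
  0≤recip n rewrite recip-mkℚ n = nonNegative⁻¹ (mkℚ (ℤ.+ 1) n (1-coprimeTo (suc n)))

  ≤ι : ∀ q → q ≤ ι ℤ.∣ ↥ q ∣
  ≤ι q@(mkℚ (ℤ.+ a) d _) rewrite ι-mkℚ a =
    *≤* (ℤₚ.*-monoˡ-≤-nonNeg (ℤ.+ a) (ℤ.+≤+ (s≤s z≤n)))
  ≤ι q@(mkℚ (-[1+ a ]) d _) rewrite ι-mkℚ (suc a) = *≤* ℤ.-≤+

  -ι≤ : ∀ q → - ι ℤ.∣ ↥ q ∣ ≤ q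
  -ι≤ q = subst₂ (λ a p → - ι a ≤ p) (trans (cong ℤ.∣_∣ (↥-neg q)) (ℤₚ.∣-i∣≡∣i∣ (↥ q))) (⁻¹-involutive q)
    (neg-antimono-≤ (≤ι (- q)))

  *-monoʳ-≤ : ∀ {p q r} → 0ℚ ≤ p → q ≤ r → p * q ≤ p * r
  *-monoʳ-≤ {p} 0≤p = *-monoˡ-≤-nonNeg p {{nonNegative 0≤p}}

  *-monoˡ-≤ : ∀ {p q r} → 0ℚ ≤ p → q ≤ r → q * p ≤ r * p
  *-monoˡ-≤ {p} 0≤p = *-monoʳ-≤-nonNeg p {{nonNegative 0≤p}}

  *-mono-≤ : ∀ {p q r s} → 0ℚ ≤ p → 0ℚ ≤ s → p ≤ q → r ≤ s → p * r ≤ q * s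
  *-mono-≤ 0≤p 0≤s p≤q r≤s = ≤-trans (*-monoʳ-≤ 0≤p r≤s) (*-monoˡ-≤ 0≤s p≤q)

  0≤* : ∀ {p q} → 0ℚ ≤ p → 0ℚ ≤ q → 0ℚ ≤ p * q
  0≤* {p} 0≤p 0≤q = ≤-trans (≤-reflexive (sym (*-zeroʳ p))) (*-monoʳ-≤ 0≤p 0≤q)

  0≤^ : ∀ {p} → 0ℚ ≤ p → ∀ n → 0ℚ ≤ p ^ᵠ n
  0≤^ 0≤p zero    = nonNegative⁻¹ 1ℚ
  0≤^ 0≤p (suc n) = 0≤* 0≤p (0≤^ 0≤p n)

  ^-mono : ∀ {p q} → 0ℚ ≤ p → p ≤ q → ∀ n → p ^ᵠ n ≤ q ^ᵠ n
  ^-mono 0≤p p≤q zero    = ≤-refl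
  ^-mono 0≤p p≤q (suc n) = *-mono-≤ 0≤p (0≤^ (≤-trans 0≤p p≤q) n) p≤q (^-mono 0≤p p≤q n)

  0≤1+ : ∀ {x} → 0ℚ ≤ x → 0ℚ ≤ 1ℚ + x
  0≤1+ 0≤x = +-mono-≤ (nonNegative⁻¹ 1ℚ) 0≤x

  bernoulli : ∀ {x} → 0ℚ ≤ x → ∀ j → 1ℚ + ι j * x ≤ (1ℚ + x) ^ᵠ j
  bernoulli {x} 0≤x zero    = ≤-reflexive (trans (cong (1ℚ +_) (*-zeroˡ x)) (+-identityʳ 1ℚ))
  bernoulli {x} 0≤x (suc j) = begin
    1ℚ + ι (suc j) * x                  ≡⟨ cong (λ i → 1ℚ + i * x) (ι-+ 1 j) ⟩
    1ℚ + (1ℚ + ι j) * x                 ≡⟨ +-identityʳ _ ⟨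
    1ℚ + (1ℚ + ι j) * x + 0ℚ            ≤⟨ +-monoʳ-≤ (1ℚ + (1ℚ + ι j) * x) (0≤* (0≤ι j) (0≤* 0≤x 0≤x)) ⟩
    1ℚ + (1ℚ + ι j) * x + ι j * (x * x) ≡⟨ solve 2 (λ i x → con 1ℚ :+ (con 1ℚ :+ i) :* x :+ i :* (x :* x)
                                              := (con 1ℚ :+ x) :* (con 1ℚ :+ i :* x)) refl (ι j) x ⟩
    (1ℚ + x) * (1ℚ + ι j * x)           ≤⟨ *-monoʳ-≤ (0≤1+ 0≤x) (bernoulli 0≤x j) ⟩
    (1ℚ + x) * (1ℚ + x) ^ᵠ j            ∎
    where
    open ≤-Reasoning
    open +-*-Solver

  -- A reverse Bernoulli inequality. One more factor creates the quadratic term `2 j x · x`, which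
  -- is at most `x` as long as `2 M x ≤ 1`; the doubled linear coefficient leaves room for it.
  ^-upper : ∀ {x} → 0ℚ ≤ x → ∀ M → ι (2 ℕ.* M) * x ≤ 1ℚ → ∀ j → j ℕ.≤ M → (1ℚ + x) ^ᵠ j ≤ 1ℚ + ι (2 ℕ.* j) * x
  ^-upper {x} 0≤x M small zero    _   = ≤-reflexive (sym (trans (cong (1ℚ +_) (*-zeroˡ x)) (+-identityʳ 1ℚ)))
  ^-upper {x} 0≤x M small (suc j) j<M = begin
    (1ℚ + x) * (1ℚ + x) ^ᵠ j       ≤⟨ *-monoʳ-≤ (0≤1+ 0≤x) (^-upper 0≤x M small j (ℕₚ.<⇒≤ j<M)) ⟩
    (1ℚ + x) * (1ℚ + i * x)        ≡⟨ solve 2 (λ i x → (con 1ℚ :+ x) :* (con 1ℚ :+ i :* x)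
                                        := con 1ℚ :+ i :* x :+ x :+ i :* x :* x) refl i x ⟩
    1ℚ + i * x + x + i * x * x     ≤⟨ +-monoʳ-≤ (1ℚ + i * x + x) (*-monoˡ-≤ 0≤x
                                        (≤-trans (*-monoˡ-≤ 0≤x (ι-mono (ℕₚ.*-monoʳ-≤ 2 (ℕₚ.<⇒≤ j<M)))) small)) ⟩
    1ℚ + i * x + x + 1ℚ * x        ≡⟨ solve 2 (λ i x → con 1ℚ :+ i :* x :+ x :+ con 1ℚ :* x
                                        := con 1ℚ :+ (con 1ℚ :+ con 1ℚ :+ i) :* x) refl i x ⟩
    1ℚ + (ι 2 + i) * x             ≡⟨ cong (λ i → 1ℚ + i * x) (ι-+ 2 (2 ℕ.* j)) ⟨
    1ℚ + ι (2 ℕ.+ 2 ℕ.* j) * x     ≡⟨ cong (λ i → 1ℚ + ι i * x) (ℕₚ.*-suc 2 j) ⟨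
    1ℚ + ι (2 ℕ.* suc j) * x       ∎
    where
    open ≤-Reasoning
    open +-*-Solver
    i = ι (2 ℕ.* j)

  -- Along n + 1 = M · R the sequence expSeq R n is ((1 + 1/M)ᴹ)ᴿ.
  module Subsequence (R′ M′ : ℕ) where
    R M n : ℕ
    R = suc R′
    M = suc M′
    n = R′ ℕ.+ M′ ℕ.* R

    y : ℚ
    y = ι R * recip n

    M*y : ι M * y ≡ 1ℚ
    M*y = trans (sym (*-assoc (ι M) (ι R) (recip n))) (trans (cong (_* recip n) (sym (ι-* M R))) (ι*recip n))

    0≤y : 0ℚ ≤ y
    0≤y = 0≤* (0≤ι R) (0≤recip n)

    M′≤n : M′ ℕ.≤ n
    M′≤n = ℕₚ.≤-trans (ℕₚ.m≤m*n M′ R) (ℕₚ.m≤n+m _ R′)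

    power : ∀ p → p ^ᵠ suc n ≡ (p ^ᵠ M) ^ᵠ R
    power p = sym (Exp.^-assocʳ p M R)

  -- This is `2 ≤ e`: by Bernoulli `(1 + 1/M)^M` is at least 2 for every `M`, so a single index
  -- beyond the threshold `N` is enough.
  exp-lower : ∀ {r q} R → 1 ℕ.≤ R → ι R ≤ r → e^ r < q → ι (2 ℕ.^ R) < q
  exp-lower {r} {q} (suc R′) _ R≤r (s , s<q , N , bound) = ≤-<-trans (begin
    ι (2 ℕ.^ R)              ≡⟨ ι-^ 2 R ⟩
    (1ℚ + 1ℚ) ^ᵠ R           ≡⟨ cong (λ z → (1ℚ + z) ^ᵠ R) M*y ⟨
    (1ℚ + ι M * y) ^ᵠ R      ≤⟨ ^-mono (0≤1+ (0≤* (0≤ι M) 0≤y)) (bernoulli 0≤y M) R ⟩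
    ((1ℚ + y) ^ᵠ M) ^ᵠ R     ≡⟨ power (1ℚ + y) ⟨
    (1ℚ + y) ^ᵠ suc n        ≤⟨ ^-mono (0≤1+ 0≤y) (+-monoʳ-≤ 1ℚ (*-monoˡ-≤ (0≤recip n) R≤r)) (suc n) ⟩
    expSeq r n               ≤⟨ bound n M′≤n ⟩
    s                        ∎) s<q
    where
    open Subsequence R′ N
    open ≤-Reasoning

  -- This is `e ≤ 4`: along `n + 1 = 2 S M` the number `z = S / (n + 1)` equals `1 / (2 M)`, so
  -- `(1 + z)^M ≤ 2` by `^-upper`, and the power `n + 1` is at most `2^(2 S)`.
  exp-upper : ∀ {r q} R → 1 ℕ.≤ R → q ≤ ι R → r <e^ q → r < ι (2 ℕ.^ (2 ℕ.* R))
  exp-upper {r} {q} S@(suc R′) 1≤R q≤S (s , r<s , N , bound) = <-≤-trans r<s (begin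
    s                                ≤⟨ bound n (ℕₚ.≤-trans (ℕₚ.m≤m+n N A) M′≤n) ⟩
    (1ℚ + q * x) ^ᵠ suc n            ≤⟨ ^-mono 0≤1+qx (+-monoʳ-≤ 1ℚ (*-monoˡ-≤ (0≤recip n) q≤S)) (suc n) ⟩
    (1ℚ + z) ^ᵠ suc n                ≡⟨ power (1ℚ + z) ⟩
    ((1ℚ + z) ^ᵠ M) ^ᵠ R             ≤⟨ ^-mono (0≤^ (0≤1+ 0≤z) M) (^-upper 0≤z M (≤-reflexive 2Mz≡1) M ℕₚ.≤-refl) R ⟩
    (1ℚ + ι (2 ℕ.* M) * z) ^ᵠ R      ≡⟨ cong (λ z → (1ℚ + z) ^ᵠ R) 2Mz≡1 ⟩
    ι 2 ^ᵠ R                         ≡⟨ ι-^ 2 R ⟨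
    ι (2 ℕ.^ R)                      ∎)
    where
    open ≤-Reasoning
    -- Here `q` may be negative. Adding `A` to the index ensures `n + 1 ≥ A ≥ - q`, which keeps the
    -- base `1 + q / (n + 1)` nonnegative, as monotonicity of powers requires.
    A = ℤ.∣ ↥ q ∣
    open Subsequence (R′ ℕ.+ (S ℕ.+ 0)) (N ℕ.+ A)
    x = recip n
    z = ι S * x
    0≤z : 0ℚ ≤ z
    0≤z = 0≤* (0≤ι S) (0≤recip n)
    A≤n : A ℕ.≤ suc n
    A≤n = ℕₚ.≤-trans (ℕₚ.m≤n+m A N) (ℕₚ.m≤n⇒m≤1+n M′≤n)
    0≤1+qx : 0ℚ ≤ 1ℚ + q * x
    0≤1+qx = begin
      0ℚ                         ≡⟨ +-inverseʳ 1ℚ ⟨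
      1ℚ + - 1ℚ                  ≡⟨ cong (λ p → 1ℚ + - p) (ι*recip n) ⟨
      1ℚ + - (ι (suc n) * x)     ≤⟨ +-monoʳ-≤ 1ℚ (neg-antimono-≤ (*-monoˡ-≤ (0≤recip n) (ι-mono A≤n))) ⟩
      1ℚ + - (ι A * x)           ≡⟨ cong (1ℚ +_) (neg-distribˡ-* (ι A) x) ⟩
      1ℚ + - ι A * x             ≤⟨ +-monoʳ-≤ 1ℚ (*-monoˡ-≤ (0≤recip n) (-ι≤ q)) ⟩
      1ℚ + q * x                 ∎
    2Mz≡1 : ι (2 ℕ.* M) * z ≡ 1ℚ
    2Mz≡1 = begin-equality
      ι (2 ℕ.* M) * z            ≡⟨ *-assoc (ι (2 ℕ.* M)) (ι S) x ⟨
      ι (2 ℕ.* M) * ι S * x      ≡⟨ cong (_* x) (ι-* (2 ℕ.* M) S) ⟨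
      ι (2 ℕ.* M ℕ.* S) * x      ≡⟨ cong (λ m → ι m * x) (trans (cong (ℕ._* S) (ℕₚ.*-comm 2 M)) (ℕₚ.*-assoc M 2 S)) ⟩
      ι (M ℕ.* R) * x            ≡⟨ ι*recip n ⟩
      1ℚ                         ∎

  <e^-mono : ∀ {r q q′} → 0ℚ ≤ q → q ≤ q′ → r <e^ q → r <e^ q′
  <e^-mono 0≤q q≤q′ (s , r<s , N , bound) = s , r<s , N , λ n N≤n → ≤-trans (bound n N≤n)
    (^-mono (0≤1+ (0≤* 0≤q (0≤recip n))) (+-monoʳ-≤ 1ℚ (*-monoˡ-≤ (0≤recip n) q≤q′)) (suc n))

  -- Replaces each e in the j-fold iterated exponential by 4.
  bound : ℕ → ℕ → ℕ
  bound zero    x = x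
  bound (suc j) x = bound j (2 ℕ.^ (2 ℕ.* x))

  -- A bound on an iterated logarithm unwinds to a chain of rationals, each below `e` to the power
  -- of the next; `exp-upper` turns the links into integer bounds one at a time.
  <bound : ∀ j {n y} R → 1 ℕ.≤ R → y ≤ ι R → log₍ j ₎ (fromℕ n) y → n ℕ.< bound j R
  <bound zero    R 1≤R y≤R n<y               = ι-cancel-< (<-≤-trans n<y y≤R)
  <bound (suc j) R 1≤R y≤R (r , logr , r<e^y) =
    <bound j (2 ℕ.^ (2 ℕ.* R)) (ℕₚ.m^n>0 2 (2 ℕ.* R)) (<⇒≤ (exp-upper R 1≤R y≤R r<e^y)) logr

  -- A tower of fours lies below a tower of twos with a slightly larger top. The invariant survives
  -- an exponentiation because `2 · 4^x + 2 ≤ 4 · 4^x = 2^(2 x + 2)`.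
  bound≤tower : ∀ j {x w} → 2 ℕ.* x ℕ.+ 2 ℕ.≤ w → 2 ℕ.* bound j x ℕ.+ 2 ℕ.≤ tower j w
  bound≤tower zero    le = le
  bound≤tower (suc j) {x} {w} le = bound≤tower j (begin
    2 ℕ.* y ℕ.+ 2              ≤⟨ ℕₚ.+-monoʳ-≤ (2 ℕ.* y) (ℕₚ.*-monoʳ-≤ 2 (ℕₚ.m^n>0 2 (2 ℕ.* x))) ⟩
    2 ℕ.* y ℕ.+ 2 ℕ.* y        ≡⟨ cong (2 ℕ.* y ℕ.+_) (ℕₚ.+-identityʳ (2 ℕ.* y)) ⟨
    2 ℕ.^ (2 ℕ.+ 2 ℕ.* x)      ≡⟨ cong (2 ℕ.^_) (ℕₚ.+-comm 2 (2 ℕ.* x)) ⟩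
    2 ℕ.^ (2 ℕ.* x ℕ.+ 2)      ≤⟨ ℕₚ.^-monoʳ-≤ 2 le ⟩
    2 ℕ.^ w                    ≡⟨ cube≡2^ w ⟨
    cube w                     ∎)
    where
    open ℕₚ.≤-Reasoning
    y = 2 ℕ.^ (2 ℕ.* x)

  -- The two asymptotic estimates

  least : ∀ B {s} → 0ℚ < s → s ≤ ι B → ∃[ u ] ι u < s × s ≤ ι (suc u)
  least zero    0<s s≤0 = ⊥-elim (<-irrefl refl (<-≤-trans 0<s s≤0))
  least (suc B) {s} 0<s s≤B with s ≤? ι B
  ... | yes s≤B′ = least B 0<s s≤B′
  ... | no  s≰B′ = B , ≰⇒> s≰B′ , s≤B

  colors≤ : ∀ A u → A ℕ.* 2 ℕ.^ (3 ℕ.* (2 ℕ.* suc u)) ℕ.≤ 2 ℕ.^ ((6 ℕ.+ A) ℕ.* suc u)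
  colors≤ A u = begin
    A ℕ.* 2 ℕ.^ (3 ℕ.* (2 ℕ.* suc u))      ≤⟨ ℕₚ.*-monoˡ-≤ (2 ℕ.^ (3 ℕ.* (2 ℕ.* suc u))) 
                                                (ℕₚ.≤-trans (ℕₚ.m≤m*n A (suc u)) (ℕₚ.<⇒≤ (n<2^n (A ℕ.* suc u)))) ⟩
    2 ℕ.^ (A ℕ.* suc u) ℕ.* 2 ℕ.^ (3 ℕ.* (2 ℕ.* suc u)) ≡⟨ ℕₚ.^-distribˡ-+-* 2 (A ℕ.* suc u) _ ⟨
    2 ℕ.^ (A ℕ.* suc u ℕ.+ 3 ℕ.* (2 ℕ.* suc u)) ≡⟨ cong (λ e → 2 ℕ.^ (A ℕ.* suc u ℕ.+ e)) (ℕₚ.*-assoc 3 2 (suc u)) ⟨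
    2 ℕ.^ (A ℕ.* suc u ℕ.+ 6 ℕ.* suc u) ≡⟨ cong (2 ℕ.^_) (ℕₚ.+-comm (A ℕ.* suc u) (6 ℕ.* suc u)) ⟩
    2 ℕ.^ (6 ℕ.* suc u ℕ.+ A ℕ.* suc u) ≡⟨ cong (2 ℕ.^_) (ℕₚ.*-distribʳ-+ (suc u) 6 A) ⟨
    2 ℕ.^ ((6 ℕ.+ A) ℕ.* suc u) ∎
    where
    open ℕₚ.≤-Reasoning
    n<2^n : ∀ n → n ℕ.< 2 ℕ.^ n
    n<2^n zero    = s≤s z≤n
    n<2^n (suc n) = ℕₚ.+-mono-≤ (ℕₚ.m^n>0 2 n) (ℕₚ.≤-trans (n<2^n n) (ℕₚ.≤-reflexive (sym (ℕₚ.+-identityʳ _))))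

  0<ι : ∀ n → 1 ℕ.≤ n → 0ℚ < ι n
  0<ι (suc n) _ rewrite ι-mkℚ (suc n) = positive⁻¹ (mkℚ (ℤ.+ suc n) 0 (Coprime.sym (1-coprimeTo (suc n))))

  square≤ : ∀ {s} u → 0ℚ < s → s ≤ ι u → s * s ≤ ι (u ℕ.* u)
  square≤ u 0<s s≤u = ≤-trans (*-mono-≤ (<⇒≤ 0<s) (0≤ι u) s≤u s≤u) (≤-reflexive (sym (ι-* u u)))

  module _ (A j : ℕ) (P : ℕ → ℕ → Set)
    (few : ∀ t {n} → n ℕ.≤ tower j (suc t ℕ.* suc t) → ∀ m → P n m → m ℕ.≤ A ℕ.* 2 ℕ.^ (3 ℕ.* suc t)) where

    -- A rational `s` above the square root is rounded up to an integer `u`. Then `n` lies below a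
    -- tower with top `(2 u)²`, so `few` bounds `m` by `2^((6 + A) u)`, and `exp-lower` compares
    -- this with `q`.
    expSqrtBound : ∃[ C ] 0ℚ < C × Eventually (λ n → ∀ m → P n m → fromℕ m ≼ exp (C · √ (log₍ j ₎ (fromℕ n))))
    expSqrtBound = C , 0<ι (2 ℕ.* (6 ℕ.+ A)) (s≤s z≤n) , bound j 1 , go
      where
      C : ℚ
      -- The 6 comes from the exponent `3 · 2 u` of `few`, `A` absorbs the constant factor since
      -- `A ≤ 2^(A u)`, and the outer 2 pays for rounding: `u ≤ 2 (u - 1)` and `u - 1 < s`.
      C = ι (2 ℕ.* (6 ℕ.+ A))
      go : ∀ n → bound j 1 ℕ.≤ n → ∀ m → P n m → fromℕ m ≼ exp (C · √ (log₍ j ₎ (fromℕ n)))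
      go n N≤n m p {q} (r , (s , (0<s , logs²) , Cs≤r) , e^r<q) with least ℤ.∣ ↥ s ∣ 0<s (≤ι s)
      -- The rounding estimate needs `u ≥ 2`; if `s ≤ 1`, then `n` would lie below the threshold
      -- `bound j 1`.
      ... | zero  , _   , s≤1 = ⊥-elim (ℕₚ.<⇒≱ (<bound j 1 ℕₚ.≤-refl (square≤ 1 0<s s≤1) logs²) N≤n)
      ... | suc v , v<s , s≤u = ≤-<-trans (ι-mono m≤) (exp-lower ((6 ℕ.+ A) ℕ.* u) (s≤s z≤n) R≤r e^r<q)
        where
        u = 2 ℕ.+ v
        2u²+2≤ : 2 ℕ.* (u ℕ.* u) ℕ.+ 2 ℕ.≤ 2 ℕ.* u ℕ.* (2 ℕ.* u)
        2u²+2≤ = begin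
          2 ℕ.* (u ℕ.* u) ℕ.+ 2                   ≤⟨ ℕₚ.+-monoʳ-≤ (2 ℕ.* (u ℕ.* u)) 
                                                         (ℕₚ.*-monoʳ-≤ 2 {1} {u ℕ.* u} (s≤s z≤n)) ⟩
          2 ℕ.* (u ℕ.* u) ℕ.+ 2 ℕ.* (u ℕ.* u)     ≡⟨ solve 1 (λ u → con 2 :* (u :* u) :+ con 2 :* (u :* u)
                                                      := con 2 :* u :* (con 2 :* u)) refl u ⟩
          2 ℕ.* u ℕ.* (2 ℕ.* u)                   ∎
          where
          open ℕₚ.≤-Reasoning
          open ℕ-Solver.+-*-Solver
        n≤ : n ℕ.≤ tower j (2 ℕ.* u ℕ.* (2 ℕ.* u))
        n≤ = ℕₚ.≤-trans (ℕₚ.<⇒≤ (<bound j (u ℕ.* u) (s≤s z≤n) (square≤ u 0<s s≤u) logs²))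
          (ℕₚ.≤-trans (ℕₚ.≤-trans (ℕₚ.m≤m+n _ _) (ℕₚ.m≤m+n _ 2)) (bound≤tower j 2u²+2≤))
        m≤ : m ℕ.≤ 2 ℕ.^ ((6 ℕ.+ A) ℕ.* u)
        m≤ = ℕₚ.≤-trans (few (suc v ℕ.+ (u ℕ.+ 0)) n≤ m p) (colors≤ A (suc v))
        u≤ : (6 ℕ.+ A) ℕ.* u ℕ.≤ 2 ℕ.* (6 ℕ.+ A) ℕ.* suc v
        u≤ = begin
          (6 ℕ.+ A) ℕ.* u                   ≤⟨ ℕₚ.*-monoʳ-≤ (6 ℕ.+ A) (s≤s (ℕₚ.m≤n⇒m≤o+n v (s≤s (ℕₚ.m≤m+n v 0)))) ⟩
          (6 ℕ.+ A) ℕ.* (2 ℕ.* suc v)       ≡⟨ ℕₚ.*-assoc (6 ℕ.+ A) 2 (suc v) ⟨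
          (6 ℕ.+ A) ℕ.* 2 ℕ.* suc v         ≡⟨ cong (ℕ._* suc v) (ℕₚ.*-comm (6 ℕ.+ A) 2) ⟩
          2 ℕ.* (6 ℕ.+ A) ℕ.* suc v         ∎
          where open ℕₚ.≤-Reasoning
        R≤r : ι ((6 ℕ.+ A) ℕ.* u) ≤ r
        R≤r = begin
          ι ((6 ℕ.+ A) ℕ.* u)               ≤⟨ ι-mono u≤ ⟩
          ι (2 ℕ.* (6 ℕ.+ A) ℕ.* suc v)     ≡⟨ ι-* (2 ℕ.* (6 ℕ.+ A)) (suc v) ⟩
          C * ι (suc v)                     ≤⟨ *-monoʳ-≤ (0≤ι (2 ℕ.* (6 ℕ.+ A))) (<⇒≤ v<s) ⟩
          C * s                             ≤⟨ Cs≤r ⟩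
          r                                 ∎
          where open ≤-Reasoning

  -- Put a = ε / C. For rational y > L = log₍ suc j ₎ n, the rational a y bounds
  -- √L once a² y ≥ 1, and then C (a y) = ε y.
  expSqrtNegligible : ∀ j C → 0ℚ < C → ∀ ε → 0ℚ < ε →
    Eventually (λ n → exp (C · √ (log₍ suc j ₎ (fromℕ n))) ≼ log₍ j ₎ (fromℕ n) ^ʳ ε)
  expSqrtNegligible j C 0<C ε 0<ε = bound (suc j) (suc B) , go
    where
    instance
      C-pos : Positive C
      C-pos = positive 0<C
      ε-pos : Positive ε
      ε-pos = positive 0<ε
      C≢0 : NonZero C
      C≢0 = pos⇒nonZero C
      1/C-pos : Positive (1/ C)
      1/C-pos = 1/pos⇒pos C
    a : ℚ
    a = ε * 1/ C
    instance
      a-pos : Positive a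
      a-pos = pos*pos⇒pos ε (1/ C)
      a²-pos : Positive (a * a)
      a²-pos = pos*pos⇒pos a a
      a²≢0 : NonZero (a * a)
      a²≢0 = pos⇒nonZero (a * a)
    -- An integer above `1 / a²`: for `n` beyond the threshold, `y` exceeds it, which yields
    -- `a² y ≥ 1`.
    B : ℕ
    B = ℤ.∣ ↥ (1/ (a * a)) ∣
    Ca≡ε : C * a ≡ ε
    Ca≡ε = begin
      C * (ε * 1/ C)   ≡⟨ cong (C *_) (*-comm ε (1/ C)) ⟩
      C * (1/ C * ε)   ≡⟨ *-assoc C (1/ C) ε ⟨
      C * 1/ C * ε     ≡⟨ cong (_* ε) (*-inverseʳ C) ⟩
      1ℚ * ε           ≡⟨ *-identityˡ ε ⟩
      ε                ∎
      where open ≡-Reasoning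
    go : ∀ n → bound (suc j) (suc B) ℕ.≤ n → exp (C · √ (log₍ suc j ₎ (fromℕ n))) ≼ log₍ j ₎ (fromℕ n) ^ʳ ε
    go n N≤n {q} (r , (y , (x , logx , x<e^y) , εy≤r) , e^r<q) =
      r , (a * y , (0<ay , x , logx , <e^-mono (<⇒≤ 0<y) y≤a²y² x<e^y) , Cay≤r) , e^r<q
      where
      B<y : ι (suc B) < y
      B<y = ≰⇒> λ y≤B → ℕₚ.<⇒≱ (<bound (suc j) (suc B) (s≤s z≤n) y≤B (x , logx , x<e^y)) N≤n
      0<y : 0ℚ < y
      0<y = <-trans (<-≤-trans (0<ι 1 ℕₚ.≤-refl) (ι-mono (s≤s (z≤n {B})))) B<y
      0<ay : 0ℚ < a * y
      0<ay = positive⁻¹ (a * y) {{pos*pos⇒pos a y {{positive 0<y}}}}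
      1≤a²y : 1ℚ ≤ a * a * y
      1≤a²y = begin
        1ℚ                       ≡⟨ *-inverseʳ (a * a) ⟨
        a * a * 1/ (a * a)       ≤⟨ *-monoʳ-≤ 0≤a² (≤ι (1/ (a * a))) ⟩
        a * a * ι B              ≤⟨ *-monoʳ-≤ 0≤a² (≤-trans (ι-mono (ℕₚ.n≤1+n B)) (<⇒≤ B<y)) ⟩
        a * a * y                ∎
        where
        open ≤-Reasoning
        0≤a² = <⇒≤ (positive⁻¹ (a * a))
      y≤a²y² : y ≤ a * y * (a * y)
      y≤a²y² = begin
        y                  ≡⟨ *-identityˡ y ⟨
        1ℚ * y             ≤⟨ *-monoˡ-≤ (<⇒≤ 0<y) 1≤a²y ⟩
        a * a * y * y      ≡⟨ solve 2 (λ a y → a :* a :* y :* y := a :* y :* (a :* y)) refl a y ⟩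
        a * y * (a * y)    ∎
        where
        open ≤-Reasoning
        open +-*-Solver
      Cay≤r : C * (a * y) ≤ r
      Cay≤r = ≤-trans (≤-reflexive (trans (sym (*-assoc C a y)) (cong (_* y) Ca≡ε))) εy≤r

open import Data.Bool using (Bool; true; false)
open import Data.Bool.Base using (b≤b; f≤t) renaming (_≤_ to _≤ᵇ_)
import Data.Bool.Properties as Boolₚ
open import Data.Empty using (⊥-elim)
open import Data.Fin as Fin using (Fin; combine; funToFin; finToFun; toℕ; fromℕ<)
import Data.Fin.Properties as Finₚ
open import Data.Fin.Subset using (Subset; ⁅_⁆; _⊆_; _∈_; ∣_∣) renaming (⊥ to ∅)
open import Data.Fin.Subset.Properties using (∣⊥∣≡0; ∣⁅x⁆∣≡1)
open import Data.Nat as ℕ using (ℕ; zero; suc; _+_; _*_; _∸_; _^_; _≤_; z≤n; s≤s)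
open import Data.Nat.DivMod using (_mod_; m%n<n; m<n⇒m%n≡m)
import Data.Nat.Properties as ℕₚ
open import Data.Product using (Σ-syntax; ∃; ∃-syntax; ∃₂; _×_; _,_; proj₁; proj₂)
open import Data.Rational using (ℚ; 0ℚ; _<_)
open import Data.Sum using (_⊎_; inj₁; inj₂; [_,_]′)
open import Data.Vec using (Vec; []; _∷_; _++_; take; drop; here; there)
open import Data.Vec.Properties using (take++drop≡id; ++-injectiveˡ; ++-injectiveʳ)
open import Data.Vec.Relation.Binary.Pointwise.Inductive as Pointwise using (Pointwise; []; _∷_; ++⁺)
open import Function using (_∘_; case_of_)
open import Relation.Binary.PropositionalEquality
open import Relation.Nullary using (Dec; yes; no)

open Asymptotics using (cube; cube≡2^; tower; expSqrtBound; expSqrtNegligible)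

private variable
  A B C D : Set
  N a b k m n s : ℕ

-- Subsets of the cube as trees

Two : (A → C) → Set
Two c = ∃₂ λ x y → c x ≢ c y

Three : (A → C) → Set
Three c = ∃[ x ] ∃[ y ] ∃[ z ] c x ≢ c y × c x ≢ c z × c y ≢ c z

module _ {c : A → C} {d : B → D} (f : A → B) (reflects : ∀ x y → d (f x) ≡ d (f y) → c x ≡ c y) where

  mapTwo : Two c → Two d
  mapTwo (x , y , x≢y) = f x , f y , x≢y ∘ reflects x y

  mapThree : Three c → Three d
  mapThree (x , y , z , x≢y , x≢z , y≢z) =
    f x , f y , f z , x≢y ∘ reflects x y , x≢z ∘ reflects x z , y≢z ∘ reflects y z

-- A Tree N is a subset of {0,1}ᴺ with at least two elements, split by the
-- leading bit; a point that is alone in its half is stored as such.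
Point : ℕ → Set
Point = Vec Bool

data Tree : ℕ → Set where
  lo hi : Tree N → Tree (suc N)
  ends  : Point N → Point N → Tree (suc N)
  right : Point N → Tree N → Tree (suc N)
  left  : Tree N → Point N → Tree (suc N)
  fork  : Tree N → Tree N → Tree (suc N)

size : Tree N → ℕ
size (lo X)      = size X
size (hi X)      = size X
size (ends _ _)  = 2
size (right _ X) = suc (size X)
size (left X _)  = suc (size X)
size (fork X Y)  = size X + size Y

-- The splitting levels; the value below a fork is never used.
levels : Tree N → Subset N
levels (lo X)      = false ∷ levels X
levels (hi X)      = false ∷ levels X
levels (ends _ _)  = true ∷ ∅
levels (right _ X) = true ∷ levels X
levels (left X _)  = true ∷ levels X
levels (fork _ _)  = ∅

-- A turn tells in which half the tree goes on after a lone point is split off; `stop` holds the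
-- number of points on the left of the fork. Levels without a branching leave no trace, so the
-- number of shapes is bounded in terms of the size alone, whatever `N` is.
data Shape : Set where
  end  : Shape
  stop : ℕ → Shape
  turnˡ turnʳ  : Shape → Shape

shape : Tree N → Shape
shape (lo X)      = shape X
shape (hi X)      = shape X
shape (ends _ _)  = end
shape (right _ X) = turnʳ (shape X)
shape (left X _)  = turnˡ (shape X)
shape (fork X _)  = stop (size X)

infix 4 _∈ᵗ_ _⊑_

data _∈ᵗ_ : Point N → Tree N → Set where
  lo     : ∀ {p} {X : Tree N} → p ∈ᵗ X → false ∷ p ∈ᵗ lo X
  hi     : ∀ {p} {X : Tree N} → p ∈ᵗ X → true ∷ p ∈ᵗ hi X
  ends₀  : ∀ {p q : Point N} → false ∷ p ∈ᵗ ends p q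
  ends₁  : ∀ {p q : Point N} → true ∷ q ∈ᵗ ends p q
  right₀ : ∀ {p} {X : Tree N} → false ∷ p ∈ᵗ right p X
  right₁ : ∀ {p q} {X : Tree N} → q ∈ᵗ X → true ∷ q ∈ᵗ right p X
  left₀  : ∀ {p q} {X : Tree N} → q ∈ᵗ X → false ∷ q ∈ᵗ left X p
  left₁  : ∀ {p} {X : Tree N} → true ∷ p ∈ᵗ left X p
  fork₀  : ∀ {p} {X Y : Tree N} → p ∈ᵗ X → false ∷ p ∈ᵗ fork X Y
  fork₁  : ∀ {p} {X Y : Tree N} → p ∈ᵗ Y → true ∷ p ∈ᵗ fork X Y

-- Transitivity can be a constructor because a derivation is only ever translated into an inclusion
-- of bit vectors.
data _⊑_ : Tree N → Tree N → Set where
  self       : {X : Tree N} → X ⊑ X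
  ⊑-trans    : {X Y Z : Tree N} → X ⊑ Y → Y ⊑ Z → X ⊑ Z
  lo         : {X X′ : Tree N} → X ⊑ X′ → lo X ⊑ lo X′
  hi         : {X X′ : Tree N} → X ⊑ X′ → hi X ⊑ hi X′
  right      : ∀ {p} {X X′ : Tree N} → X ⊑ X′ → right p X ⊑ right p X′
  right-ends : ∀ {p q} {X : Tree N} → q ∈ᵗ X → ends p q ⊑ right p X
  right-hi   : ∀ {p} {X X′ : Tree N} → X ⊑ X′ → hi X ⊑ right p X′
  left       : ∀ {p} {X X′ : Tree N} → X ⊑ X′ → left X p ⊑ left X′ p
  left-ends  : ∀ {p q} {X : Tree N} → q ∈ᵗ X → ends q p ⊑ left X p
  left-lo    : ∀ {p} {X X′ : Tree N} → X ⊑ X′ → lo X ⊑ left X′ p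
  fork       : {X X′ Y Y′ : Tree N} → X ⊑ X′ → Y ⊑ Y′ → fork X Y ⊑ fork X′ Y′
  fork-right : ∀ {p} {X Y Y′ : Tree N} → p ∈ᵗ X → Y ⊑ Y′ → right p Y ⊑ fork X Y′
  fork-left  : ∀ {p} {X X′ Y : Tree N} → X ⊑ X′ → p ∈ᵗ Y → left X p ⊑ fork X′ Y
  fork-lo    : {X X′ Y : Tree N} → X ⊑ X′ → lo X ⊑ fork X′ Y
  fork-hi    : {X Y Y′ : Tree N} → Y ⊑ Y′ → hi Y ⊑ fork X Y′

Sub : Tree N → ℕ → Set
Sub S s = Σ[ X ∈ Tree _ ] X ⊑ S × size X ≡ s

-- Caterpillars, the trees without a fork.
data Cat : Tree N → Set where
  lo    : {X : Tree N} → Cat X → Cat (lo X)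
  hi    : {X : Tree N} → Cat X → Cat (hi X)
  ends  : {p q : Point N} → Cat (ends p q)
  right : ∀ {p} {X : Tree N} → Cat X → Cat (right p X)
  left  : ∀ {p} {X : Tree N} → Cat X → Cat (left X p)

data Forked : Tree N → Set where
  lo    : {X : Tree N} → Forked X → Forked (lo X)
  hi    : {X : Tree N} → Forked X → Forked (hi X)
  right : ∀ {p} {X : Tree N} → Forked X → Forked (right p X)
  left  : ∀ {p} {X : Tree N} → Forked X → Forked (left X p)
  fork  : {X Y : Tree N} → Forked (fork X Y)

cat⊎forked : (X : Tree N) → Cat X ⊎ Forked X
cat⊎forked (lo X) with cat⊎forked X
... | inj₁ c = inj₁ (lo c)
... | inj₂ f = inj₂ (lo f)
cat⊎forked (hi X) with cat⊎forked X
... | inj₁ c = inj₁ (hi c)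
... | inj₂ f = inj₂ (hi f)
cat⊎forked (ends _ _) = inj₁ ends
cat⊎forked (right _ X) with cat⊎forked X
... | inj₁ c = inj₁ (right c)
... | inj₂ f = inj₂ (right f)
cat⊎forked (left X _) with cat⊎forked X
... | inj₁ c = inj₁ (left c)
... | inj₂ f = inj₂ (left f)
cat⊎forked (fork _ _) = inj₂ fork

stops : Shape → Bool
stops end      = false
stops (stop _) = true
stops (turnˡ x)    = stops x
stops (turnʳ x)    = stops x

cat-stops : {X : Tree N} → Cat X → stops (shape X) ≡ false
cat-stops (lo c)    = cat-stops c
cat-stops (hi c)    = cat-stops c
cat-stops ends      = refl
cat-stops (right c) = cat-stops c
cat-stops (left c)  = cat-stops c

forked-stops : {X : Tree N} → Forked X → stops (shape X) ≡ true
forked-stops (lo f)    = forked-stops f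
forked-stops (hi f)    = forked-stops f
forked-stops (right f) = forked-stops f
forked-stops (left f)  = forked-stops f
forked-stops fork      = refl

cat≢forked : {X Y : Tree N} → Cat X → Forked Y → shape X ≢ shape Y
cat≢forked c f eq with () ← trans (sym (cat-stops c)) (trans (cong stops eq) (forked-stops f))

2≤size : (X : Tree N) → 2 ≤ size X
2≤size (lo X)      = 2≤size X
2≤size (hi X)      = 2≤size X
2≤size (ends _ _)  = s≤s (s≤s z≤n)
2≤size (right _ X) = ℕₚ.m≤n⇒m≤1+n (2≤size X)
2≤size (left X _)  = ℕₚ.m≤n⇒m≤1+n (2≤size X)
2≤size (fork X Y)  = ℕₚ.≤-trans (2≤size X) (ℕₚ.m≤m+n _ _)

forked-4≤size : {X : Tree N} → Forked X → 4 ≤ size X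
forked-4≤size (lo f)    = forked-4≤size f
forked-4≤size (hi f)    = forked-4≤size f
forked-4≤size (right f) = ℕₚ.m≤n⇒m≤1+n (forked-4≤size f)
forked-4≤size (left f)  = ℕₚ.m≤n⇒m≤1+n (forked-4≤size f)
forked-4≤size (fork {X = X} {Y}) = ℕₚ.+-mono-≤ (2≤size X) (2≤size Y)

element : (X : Tree N) → ∃ (_∈ᵗ X)
element (lo X)      = _ , lo (proj₂ (element X))
element (hi X)      = _ , hi (proj₂ (element X))
element (ends _ _)  = _ , ends₀
element (right _ _) = _ , right₀
element (left _ _)  = _ , left₁
element (fork X _)  = _ , fork₀ (proj₂ (element X))

-- Shapes of those subsets of a fork that have a points on the left and b on
-- the right.
data Split : ℕ → ℕ → Shape → Set where
  right : ∀ {x} → Split 1 b (turnʳ x)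
  left  : ∀ {x} → Split a 1 (turnˡ x)
  both  : Split a b (stop a)

-- A first `turnʳ` forces the left count to be 1, a first `turnˡ` forces the right count to be 1 and
-- the total then gives the left one, and `stop` records the left count.
split-injective : ∀ {a b a′ b′ x y} → Split a b x → Split a′ b′ y → a + b ≡ a′ + b′ → x ≡ y → a ≡ a′
split-injective right right _ refl = refl
split-injective left  left  e refl = ℕₚ.+-cancelʳ-≡ 1 _ _ e
split-injective both  both  _ refl = refl

mutual

  subset : (X : Tree N) → 2 ≤ s → s ≤ size X → Sub X s
  subset (lo X) p q = let Y , i , e = subset X p q in lo Y , lo i , e
  subset (hi X) p q = let Y , i , e = subset X p q in hi Y , hi i , e
  subset (ends x y) p q = ends x y , self , ℕₚ.≤-antisym p q
  subset {s = s} (right x X) p q with ℕₚ.m≤n⇒m<n∨m≡n q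
  ... | inj₁ (s≤s q′) = let Y , i , e = subset X p q′ in hi Y , right-hi i , e
  ... | inj₂ refl     = right x X , self , refl
  subset (left X x) p q with ℕₚ.m≤n⇒m<n∨m≡n q
  ... | inj₁ (s≤s q′) = let Y , i , e = subset X p q′ in lo Y , left-lo i , e
  ... | inj₂ refl     = left X x , self , refl
  subset {s = s} (fork X Y) p q with s ℕₚ.≤? size Y
  ... | yes s≤Y = let Z , i , e = subset Y p s≤Y in hi Z , fork-hi i , e
  ... | no  s≰Y =
    let Y≤s = ℕₚ.<⇒≤ (ℕₚ.≰⇒> s≰Y)
        Z , i , e , _ = splitSubset {a = s ∸ size Y} {b = size Y} X Y
          (ℕₚ.m<n⇒0<n∸m (ℕₚ.≰⇒> s≰Y)) (ℕₚ.m≤n+o⇒m∸n≤o s (size Y) (ℕₚ.≤-trans q (ℕₚ.≤-reflexive (ℕₚ.+-comm (size X) _))))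
          (ℕₚ.<⇒≤ (2≤size Y)) ℕₚ.≤-refl
          (ℕₚ.+-mono-≤ (ℕₚ.m<n⇒0<n∸m (ℕₚ.≰⇒> s≰Y)) (2≤size Y))
    in Z , i , trans e (ℕₚ.m∸n+n≡m Y≤s)

  -- The total is at least 3 because one point on each side gives `ends`, whose shape is not among
  -- those of `Split`.
  splitSubset : (X Y : Tree N) → 1 ≤ a → a ≤ size X → 1 ≤ b → b ≤ size Y → 3 ≤ a + b →
    Σ[ Z ∈ Tree (suc N) ] Z ⊑ fork X Y × size Z ≡ a + b × Split a b (shape Z)
  splitSubset {a = 1} {1} X Y _ _ _ _ (s≤s (s≤s ()))
  splitSubset {a = 1} {suc (suc b)} X Y _ _ _ q _ =
    let Z , i , e = subset Y (s≤s (s≤s z≤n)) q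
        x , x∈X   = element X
    in right x Z , fork-right x∈X i , cong suc e , right
  splitSubset {a = suc (suc a)} {1} X Y _ p _ _ _ =
    let Z , i , e = subset X (s≤s (s≤s z≤n)) p
        y , y∈Y   = element Y
    in left Z y , fork-left i y∈Y , trans (cong suc e) (ℕₚ.+-comm 1 _) , left
  splitSubset {a = suc (suc a)} {suc (suc b)} X Y _ p _ q _ =
    let Z , i , e = subset X (s≤s (s≤s z≤n)) p
        W , j , f = subset Y (s≤s (s≤s z≤n)) q
    in fork Z W , fork i j , cong₂ _+_ e f , subst (λ t → Split (suc (suc a)) (suc (suc b)) (stop t)) (sym e) both

-- Shapes of subtrees

pattern ≤2 = s≤s (s≤s z≤n)

shapeOf : {S : Tree N} → Sub S s → Shape
shapeOf X = shape (proj₁ X)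

turnˡ-injective : ∀ {x y} → turnˡ x ≡ turnˡ y → x ≡ y
turnˡ-injective refl = refl

turnʳ-injective : ∀ {x y} → turnʳ x ≡ turnʳ y → x ≡ y
turnʳ-injective refl = refl

module _ {S : Tree N} where

  loˢ : Sub S s → Sub (lo S) s
  loˢ (X , i , e) = lo X , lo i , e

  hiˢ : Sub S s → Sub (hi S) s
  hiˢ (X , i , e) = hi X , hi i , e

  rightˢ : ∀ p → Sub S s → Sub (right p S) (suc s)
  rightˢ p (X , i , e) = right p X , right i , cong suc e

  leftˢ : ∀ p → Sub S s → Sub (left S p) (suc s)
  leftˢ p (X , i , e) = left X p , left i , cong suc e

  right-hiˢ : ∀ p → Sub S s → Sub (right p S) s
  right-hiˢ p (X , i , e) = hi X , right-hi i , e

  left-loˢ : ∀ p → Sub S s → Sub (left S p) s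
  left-loˢ p (X , i , e) = lo X , left-lo i , e

  transˢ : (Y : Sub S s) → Sub (proj₁ Y) k → Sub S k
  transˢ (_ , j , _) (X , i , e) = X , ⊑-trans i j , e

splitˢ : (X Y : Tree N) → 1 ≤ a → a ≤ size X → 1 ≤ b → b ≤ size Y → 3 ≤ a + b → a + b ≡ s →
  Σ[ Z ∈ Sub (fork X Y) s ] Split a b (shapeOf Z)
splitˢ X Y p q p′ q′ 3≤ e = let Z , i , eZ , σ = splitSubset X Y p q p′ q′ 3≤ in (Z , i , trans eZ e) , σ

split-≢ : ∀ {a b a′ b′ x y} → Split a b x → Split a′ b′ y → a + b ≡ a′ + b′ → a ≢ a′ → x ≢ y
split-≢ σ τ e a≢a′ x≡y = a≢a′ (split-injective σ τ e x≡y)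

twoShapes : {S : Tree N} → Forked S → size S ≡ suc s → Two (shapeOf {s = s} {S})
twoShapes (lo f) e = mapTwo loˢ (λ _ _ eq → eq) (twoShapes f e)
twoShapes (hi f) e = mapTwo hiˢ (λ _ _ eq → eq) (twoShapes f e)
twoShapes {s = suc s} (right {p = p} f) e =
  mapTwo (rightˢ p) (λ _ _ → turnʳ-injective) (twoShapes f (ℕₚ.suc-injective e))
twoShapes {s = suc s} (left {p = p} f) e =
  mapTwo (leftˢ p) (λ _ _ → turnˡ-injective) (twoShapes f (ℕₚ.suc-injective e))
twoShapes {s = zero} (right {X = X} f) e = ⊥-elim (ℕₚ.<⇒≢ (ℕₚ.<⇒≤ (2≤size X)) (sym (ℕₚ.suc-injective e)))
twoShapes {s = zero} (left {X = X} f) e = ⊥-elim (ℕₚ.<⇒≢ (ℕₚ.<⇒≤ (2≤size X)) (sym (ℕₚ.suc-injective e)))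
twoShapes {s = s} (fork {X = X} {Y}) e
  with a , refl-a ← ℕₚ.m≤n⇒∃[o]m+o≡n (2≤size X)
     | b , refl-b ← ℕₚ.m≤n⇒∃[o]m+o≡n (2≤size Y) =
  let e′ : 1 + a + (2 + b) ≡ s
      e′ = ℕₚ.suc-injective (trans (cong₂ _+_ refl-a refl-b) e)
      Z , σ = splitˢ {a = 1 + a} {2 + b} X Y (s≤s z≤n) (ℕₚ.<⇒≤ (ℕₚ.≤-reflexive refl-a))
                (s≤s z≤n) (ℕₚ.≤-reflexive refl-b) (ℕₚ.+-mono-≤ (s≤s z≤n) ≤2) e′
      W , τ = splitˢ {a = 2 + a} {1 + b} X Y (s≤s z≤n) (ℕₚ.≤-reflexive refl-a)
                (s≤s z≤n) (ℕₚ.<⇒≤ (ℕₚ.≤-reflexive refl-b)) (ℕₚ.+-mono-≤ ≤2 (s≤s z≤n))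
                (trans (sym (ℕₚ.+-suc (1 + a) (1 + b))) e′)
  in Z , W , split-≢ σ τ (ℕₚ.+-suc (1 + a) (1 + b)) (ℕₚ.1+n≢n ∘ sym)

-- The shapes of the s-subsets need not take three values when one side of a
-- fork is a caterpillar; then the colours of levels help out on a caterpillar
-- Y with one point more.
CatAndForked : Tree N → ℕ → Set
CatAndForked S s = (Σ[ Y ∈ Sub S (suc s) ] Cat (proj₁ Y)) × (Σ[ Z ∈ Sub S s ] Forked (proj₁ Z))

-- Using both points of `X` gives a shape `stop`. If `Y` is forked, one point of `X` with two
-- differently shaped subsets of `Y` gives two shapes starting with `turnʳ`. If `Y` is a
-- caterpillar, it stays one when a point of `X` is added.
thinLeft : (X Y : Tree N) → size X ≡ 2 → size Y ≡ 2 + s → 2 ≤ s →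
  Three (shapeOf {s = 2 + s} {fork X Y}) ⊎ CatAndForked (fork X Y) (2 + s)
thinLeft {s = s} X Y eX eY 2≤s
  with x , x∈X ← element X
     | Y′ , i , e ← subset Y 2≤s (ℕₚ.≤-trans (ℕₚ.m≤n+m s 2) (ℕₚ.≤-reflexive (sym eY)))
     | cat⊎forked Y
... | inj₁ c = inj₂ (((right x Y , fork-right x∈X self , cong suc eY) , right c) ,
                     ((fork X Y′ , fork self i , cong₂ _+_ eX e) , fork))
... | inj₂ f =
  let (V , j , eV) , (W , k , eW) , V≢W = twoShapes f eY
  in inj₁ ((right x V , fork-right x∈X j , cong suc eV) , (right x W , fork-right x∈X k , cong suc eW) ,
           (fork X Y′ , fork self i , cong₂ _+_ eX e) , V≢W ∘ turnʳ-injective , (λ ()) , λ ())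

thinRight : (X Y : Tree N) → size X ≡ 2 + s → size Y ≡ 2 → 2 ≤ s →
  Three (shapeOf {s = 2 + s} {fork X Y}) ⊎ CatAndForked (fork X Y) (2 + s)
thinRight {s = s} X Y eX eY 2≤s
  with y , y∈Y ← element Y
     | X′ , i , e ← subset X 2≤s (ℕₚ.≤-trans (ℕₚ.m≤n+m s 2) (ℕₚ.≤-reflexive (sym eX)))
     | cat⊎forked X
... | inj₁ c = inj₂ (((left X y , fork-left self y∈Y , cong suc eX) , left c) ,
                     ((fork X′ Y , fork i self , trans (cong₂ _+_ e eY) (ℕₚ.+-comm s 2)) , fork))
... | inj₂ f =
  let (V , j , eV) , (W , k , eW) , V≢W = twoShapes f eX
  in inj₁ ((left V y , fork-left j y∈Y , cong suc eV) , (left W y , fork-left k y∈Y , cong suc eW) ,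
           (fork X′ Y , fork i self , trans (cong₂ _+_ e eY) (ℕₚ.+-comm s 2)) , V≢W ∘ turnˡ-injective , (λ ()) , λ ())

-- Two points have to go, and each side has at least three. Removing two, one or none of them on the
-- left gives three different left counts.
thick : (X Y : Tree N) → 3 + a ≡ size X → 3 + b ≡ size Y → Three (shapeOf {s = 1 + a + (3 + b)} {fork X Y})
thick {a = a} {b} X Y eX eY =
  let open ℕₚ
      up = ≤-trans
      e₂ : 2 + a + (2 + b) ≡ 1 + a + (3 + b)
      e₂ = sym (+-suc (1 + a) (2 + b))
      e₃ : 3 + a + (1 + b) ≡ 1 + a + (3 + b)
      e₃ = trans (sym (+-suc (2 + a) (1 + b))) e₂
      U , υ = splitˢ {a = 1 + a} {3 + b} X Y (s≤s z≤n) (up (m≤n+m _ 2) (≤-reflexive eX))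
                (s≤s z≤n) (≤-reflexive eY) 3≤ refl
      V , φ = splitˢ {a = 2 + a} {2 + b} X Y (s≤s z≤n) (up (m≤n+m _ 1) (≤-reflexive eX))
                (s≤s z≤n) (up (m≤n+m _ 1) (≤-reflexive eY)) (subst (3 ≤_) (sym e₂) 3≤) e₂
      W , ψ = splitˢ {a = 3 + a} {1 + b} X Y (s≤s z≤n) (≤-reflexive eX)
                (s≤s z≤n) (up (m≤n+m _ 2) (≤-reflexive eY)) (subst (3 ≤_) (sym e₃) 3≤) e₃
  in U , V , W , split-≢ υ φ (sym e₂) (1+n≢n ∘ sym) , split-≢ υ ψ (sym e₃) (λ ()) ,
     split-≢ φ ψ (trans e₂ (sym e₃)) (1+n≢n ∘ sym)
  where
  3≤ : 3 ≤ 1 + a + (3 + b)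
  3≤ = ℕₚ.≤-trans (ℕₚ.m≤m+n 3 b) (ℕₚ.m≤n+m (3 + b) (1 + a))

forkShapes : (X Y : Tree N) → size (fork X Y) ≡ 2 + s → 4 ≤ s →
  Three (shapeOf {s = s} {fork X Y}) ⊎ CatAndForked (fork X Y) s
forkShapes X Y e 4≤s
  with ℕₚ.m≤n⇒∃[o]m+o≡n (2≤size X) | ℕₚ.m≤n⇒∃[o]m+o≡n (2≤size Y) | 4≤s
... | zero , eX | _ | s≤s (s≤s 2≤s) = thinLeft X Y (sym eX) (ℕₚ.+-cancelˡ-≡ 2 _ _ (trans (cong (_+ size Y) eX) e)) 2≤s
... | suc a , eX | zero , eY | s≤s (s≤s 2≤s) =
  thinRight X Y (ℕₚ.+-cancelʳ-≡ 2 _ _ (trans (cong (size X +_) eY) (trans e (ℕₚ.+-comm 2 _)))) (sym eY) 2≤s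
... | suc a , eX | suc b , eY | _ with refl ← trans (cong₂ _+_ eX eY) e = inj₁ (thick X Y eX eY)

fourFork : {S : Tree N} → Forked S → Σ[ Z ∈ Sub S 4 ] Forked (proj₁ Z)
fourFork (lo f) = let Z , g = fourFork f in loˢ Z , lo g
fourFork (hi f) = let Z , g = fourFork f in hiˢ Z , hi g
fourFork (right {p = p} f) = let Z , g = fourFork f in right-hiˢ p Z , hi g
fourFork (left {p = p} f) = let Z , g = fourFork f in left-loˢ p Z , lo g
fourFork (fork {X = X} {Y}) =
  let V , i , e = subset X ≤2 (2≤size X)
      W , j , e′ = subset Y ≤2 (2≤size Y)
  in (fork V W , fork i j , cong₂ _+_ e e′) , fork

pair-shape : (X : Tree N) → size X ≡ 2 → shape X ≡ end
pair-shape (lo X) e = pair-shape X e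
pair-shape (hi X) e = pair-shape X e
pair-shape (ends _ _) e = refl
pair-shape (right _ X) e = ⊥-elim (ℕₚ.<⇒≢ (2≤size X) (sym (ℕₚ.suc-injective e)))
pair-shape (left X _) e = ⊥-elim (ℕₚ.<⇒≢ (2≤size X) (sym (ℕₚ.suc-injective e)))
pair-shape (fork X Y) e = ⊥-elim (ℕₚ.<⇒≢ (ℕₚ.≤-trans (ℕₚ.n≤1+n 3) (ℕₚ.+-mono-≤ (2≤size X) (2≤size Y))) (sym e))

leftTriple : {S : Tree N} → Forked S → Σ[ Z ∈ Sub S 3 ] shapeOf Z ≡ turnˡ end
leftTriple (lo f) = let Z , e = leftTriple f in loˢ Z , e
leftTriple (hi f) = let Z , e = leftTriple f in hiˢ Z , e
leftTriple (right {p = p} f) = let Z , e = leftTriple f in right-hiˢ p Z , e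
leftTriple (left {p = p} f) = let Z , e = leftTriple f in left-loˢ p Z , e
leftTriple (fork {X = X} {Y}) =
  let V , i , e = subset X ≤2 (2≤size X)
      y , y∈Y   = element Y
  in (left V y , fork-left i y∈Y , cong suc e) , cong turnˡ (pair-shape V e)

rightTriple : {S : Tree N} → Forked S → Σ[ Z ∈ Sub S 3 ] shapeOf Z ≡ turnʳ end
rightTriple (lo f) = let Z , e = rightTriple f in loˢ Z , e
rightTriple (hi f) = let Z , e = rightTriple f in hiˢ Z , e
rightTriple (right {p = p} f) = let Z , e = rightTriple f in right-hiˢ p Z , e
rightTriple (left {p = p} f) = let Z , e = rightTriple f in left-loˢ p Z , e
rightTriple (fork {X = X} {Y}) =
  let V , i , e = subset Y ≤2 (2≤size Y)
      x , x∈X   = element X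
  in (right x V , fork-right x∈X i , cong suc e) , cong turnʳ (pair-shape V e)

forked-≢ : {X : Tree N} → ∀ {x} → Forked X → stops x ≡ false → shape X ≢ x
forked-≢ f e eq with () ← trans (sym (forked-stops f)) (trans (cong stops eq) e)

-- Lone points above the fork are kept, and each lowers `s` by one. At `s = 4` the induction cannot
-- go on; there a forked four-set avoiding the lone point, and the lone point with a left-turning
-- and with a right-turning triple, have three shapes.
forkedShapes : {S : Tree N} → Forked S → size S ≡ 2 + s → 4 ≤ s →
  Three (shapeOf {s = s} {S}) ⊎ CatAndForked S s
forkedShapes (lo f) e 4≤s with forkedShapes f e 4≤s
... | inj₁ t = inj₁ (mapThree loˢ (λ _ _ eq → eq) t)
... | inj₂ ((Y , c) , (Z , g)) = inj₂ ((loˢ Y , lo c) , (loˢ Z , lo g))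
forkedShapes (hi f) e 4≤s with forkedShapes f e 4≤s
... | inj₁ t = inj₁ (mapThree hiˢ (λ _ _ eq → eq) t)
... | inj₂ ((Y , c) , (Z , g)) = inj₂ ((hiˢ Y , hi c) , (hiˢ Z , hi g))
forkedShapes {s = suc s} (right {p = p} f) e (s≤s 3≤s) with ℕₚ.m≤n⇒m<n∨m≡n 3≤s
... | inj₂ refl =
  let Z , g = fourFork f
      V , v = leftTriple f
      W , w = rightTriple f
  in inj₁ (right-hiˢ p Z , rightˢ p V , rightˢ p W ,
       forked-≢ g (cong stops v) ,
       forked-≢ g (cong stops w) ,
       λ eq → case trans (sym v) (trans (turnʳ-injective eq) w) of λ ())
... | inj₁ 4≤s with forkedShapes f (ℕₚ.suc-injective e) 4≤s
... | inj₁ t = inj₁ (mapThree (rightˢ p) (λ _ _ → turnʳ-injective) t)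
... | inj₂ ((Y , c) , (Z , g)) = inj₂ ((rightˢ p Y , right c) , (rightˢ p Z , right g))
forkedShapes {s = suc s} (left {p = p} f) e (s≤s 3≤s) with ℕₚ.m≤n⇒m<n∨m≡n 3≤s
... | inj₂ refl =
  let Z , g = fourFork f
      V , v = leftTriple f
      W , w = rightTriple f
  in inj₁ (left-loˢ p Z , leftˢ p V , leftˢ p W ,
       forked-≢ g (cong stops v) ,
       forked-≢ g (cong stops w) ,
       λ eq → case trans (sym v) (trans (turnˡ-injective eq) w) of λ ())
... | inj₁ 4≤s with forkedShapes f (ℕₚ.suc-injective e) 4≤s
... | inj₁ t = inj₁ (mapThree (leftˢ p) (λ _ _ → turnˡ-injective) t)
... | inj₂ ((Y , c) , (Z , g)) = inj₂ ((leftˢ p Y , left c) , (leftˢ p Z , left g))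
forkedShapes (fork {X = X} {Y}) = forkShapes X Y

-- Colours by shape and levels

infix 4 _≤ˢ_
-- Inclusion as a pointwise order of bits can be matched on level by level and concatenated along
-- halves.
_≤ˢ_ : Subset n → Subset n → Set
_≤ˢ_ = Pointwise _≤ᵇ_

Subsets : Subset n → ℕ → Set
Subsets S k = Σ[ E ∈ Subset _ ] E ≤ˢ S × ∣ E ∣ ≡ k

-- The field `three` is the property wanted of the colouring; `two` is applied to the levels of
-- caterpillars with `2 + k` points.
record Good (k : ℕ) (φ : Subset n → C) : Set where
  field
    two   : ∀ S → ∣ S ∣ ≡ 1 + k → Two {A = Subsets S k} (φ ∘ proj₁)
    three : ∀ S → ∣ S ∣ ≡ 2 + k → Three {A = Subsets S k} (φ ∘ proj₁)

∣p∣≡0⇒p≡∅ : (E : Subset n) → ∣ E ∣ ≡ 0 → E ≡ ∅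
∣p∣≡0⇒p≡∅ []          _ = refl
∣p∣≡0⇒p≡∅ (false ∷ E) e = cong (false ∷_) (∣p∣≡0⇒p≡∅ E e)

≤∅⇒≡∅ : {E : Subset n} → E ≤ˢ ∅ → E ≡ ∅
≤∅⇒≡∅ []         = refl
≤∅⇒≡∅ (b≤b ∷ le) = cong (false ∷_) (≤∅⇒≡∅ le)

-- Each branching of a caterpillar splits off one point, and no two branchings share a level.
cat-levels : {X : Tree N} → Cat X → suc ∣ levels X ∣ ≡ size X
cat-levels (lo c)         = cat-levels c
cat-levels (hi c)         = cat-levels c
cat-levels (ends {N = N}) = cong (suc ∘ suc) (∣⊥∣≡0 N)
cat-levels (right c)      = cong suc (cat-levels c)
cat-levels (left c)       = cong suc (cat-levels c)

LiftOf : Tree N → ℕ → Subset N → Set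
LiftOf S k E = Σ[ X ∈ Sub S (suc k) ] Cat (proj₁ X) × levels (proj₁ X) ≡ E

liftEnds : ∀ {x y} {S : Tree (suc N)} {E : Subset N} → ∣ E ∣ ≡ 0 → ends x y ⊑ S → LiftOf S 1 (true ∷ E)
liftEnds e i = (_ , i , refl) , ends , cong (true ∷_) (sym (∣p∣≡0⇒p≡∅ _ e))

-- The lone point at a level is kept if the level belongs to `E` and dropped otherwise. At the last
-- level of `E`, any single point of the remaining tree completes the final pair.
lift : {S : Tree N} {E : Subset N} → Cat S → E ≤ˢ levels S → ∣ E ∣ ≡ suc k → LiftOf S (suc k) E
lift (lo c) (b≤b ∷ le) e = let X , d , eX = lift c le e in loˢ X , lo d , cong (false ∷_) eX
lift (hi c) (b≤b ∷ le) e = let X , d , eX = lift c le e in hiˢ X , hi d , cong (false ∷_) eX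
lift (ends {N = N}) (b≤b ∷ le) e with refl ← ≤∅⇒≡∅ le
  with refl ← trans (sym (∣⊥∣≡0 N)) (ℕₚ.suc-injective e) = liftEnds (∣⊥∣≡0 N) self
lift (ends {N = N}) (f≤t ∷ le) e with refl ← ≤∅⇒≡∅ le with () ← trans (sym (∣⊥∣≡0 N)) e
lift (right {p = x} c) (f≤t ∷ le) e = let X , d , eX = lift c le e in right-hiˢ x X , hi d , cong (false ∷_) eX
lift {k = zero} (right {X = X} c) (b≤b ∷ le) e = liftEnds (ℕₚ.suc-injective e) (right-ends (proj₂ (element X)))
lift {k = suc k} (right {p = x} c) (b≤b ∷ le) e =
  let X , d , eX = lift c le (ℕₚ.suc-injective e) in rightˢ x X , right d , cong (true ∷_) eX
lift (left {p = x} c) (f≤t ∷ le) e = let X , d , eX = lift c le e in left-loˢ x X , lo d , cong (false ∷_) eX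
lift {k = zero} (left {X = X} c) (b≤b ∷ le) e = liftEnds (ℕₚ.suc-injective e) (left-ends (proj₂ (element X)))
lift {k = suc k} (left {p = x} c) (b≤b ∷ le) e =
  let X , d , eX = lift c le (ℕₚ.suc-injective e) in leftˢ x X , left d , cong (true ∷_) eX

key : (Subset N → C) → Tree N → Shape × C
key φ X = shape X , φ (levels X)

module _ (φ : Subset N → C) {S : Tree N} (c : Cat S) where

  liftˢ : Subsets (levels S) (suc k) → Sub S (2 + k)
  liftˢ (E , le , e) = proj₁ (lift c le e)

  liftˢ-cat : (E : Subsets (levels S) (suc k)) → Cat (proj₁ (liftˢ E))
  liftˢ-cat (E , le , e) = proj₁ (proj₂ (lift c le e))

  liftˢ-key : (E E′ : Subsets (levels S) (suc k)) →
    key φ (proj₁ (liftˢ E)) ≡ key φ (proj₁ (liftˢ E′)) → φ (proj₁ E) ≡ φ (proj₁ E′)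
  liftˢ-key (E , le , e) (E′ , le′ , e′) same =
    trans (cong φ (sym (proj₂ (proj₂ (lift c le e)))))
      (trans (cong proj₂ same) (cong φ (proj₂ (proj₂ (lift c le′ e′)))))

module _ {φ : Subset N → C} (good : Good (suc k) φ) {S : Tree N} where
  open Good good

  twoKeys-cat : Cat S → size S ≡ 3 + k → Two {A = Σ[ X ∈ Sub S (2 + k) ] Cat (proj₁ X)} (key φ ∘ proj₁ ∘ proj₁)
  twoKeys-cat c e = mapTwo (λ E → liftˢ φ c E , liftˢ-cat φ c E) (liftˢ-key φ c)
    (two (levels S) (ℕₚ.suc-injective (trans (cat-levels c) e)))

  twoKeys : size S ≡ 3 + k → Two {A = Sub S (2 + k)} (key φ ∘ proj₁)
  twoKeys e with cat⊎forked S
  ... | inj₁ c = mapTwo proj₁ (λ _ _ eq → eq) (twoKeys-cat c e)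
  ... | inj₂ f = mapTwo (λ X → X) (λ _ _ → cong proj₁) (twoShapes f e)

  threeKeys-cat : Cat S → size S ≡ 4 + k → Three {A = Sub S (2 + k)} (key φ ∘ proj₁)
  threeKeys-cat c e = mapThree (liftˢ φ c) (liftˢ-key φ c)
    (three (levels S) (ℕₚ.suc-injective (trans (cat-levels c) e)))

threeKeys : {φ : Subset N → C} → Good (suc k) φ → 2 ≤ k → {S : Tree N} → size S ≡ 4 + k →
  Three {A = Sub S (2 + k)} (key φ ∘ proj₁)
threeKeys good 2≤k {S} e with cat⊎forked S
... | inj₁ c = threeKeys-cat good c e
... | inj₂ f with forkedShapes f e (s≤s (s≤s 2≤k))
... | inj₁ t = mapThree (λ X → X) (λ _ _ → cong proj₁) t
... | inj₂ ((Y , c) , (Z , g)) =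
  -- The two keys found inside `Y` belong to caterpillars, so the shape of the forked `Z` differs
  -- from both.
  let (U , d) , (V , d′) , U≢V = twoKeys-cat good c (proj₂ (proj₂ Y))
  in transˢ Y U , transˢ Y V , Z , U≢V , cat≢forked d g ∘ cong proj₁ , cat≢forked d′ g ∘ cong proj₁

-- Forked five-sets over a graph colouring

pair : Fin n → Fin n → Subset n
pair Fin.zero    Fin.zero    = true ∷ ∅
pair Fin.zero    (Fin.suc y) = true ∷ ⁅ y ⁆
pair (Fin.suc x) Fin.zero    = true ∷ ⁅ x ⁆
pair (Fin.suc x) (Fin.suc y) = false ∷ pair x y

-- Taking w = y rules out monochromatic triangles; copies of K₄ with only two
-- colours are ruled out as well.
NoHook : (Subset n → C) → Set
NoHook φ = ∀ x y z w → x ≢ y → x ≢ z → y ≢ z → x ≢ w →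
  φ (pair x y) ≡ φ (pair x z) → φ (pair y z) ≢ φ (pair x w)

pairLevels : (X : Tree N) → size X ≡ 2 → ∃[ u ] levels X ≡ ⁅ u ⁆
pairLevels (lo X) e = let u , eu = pairLevels X e in Fin.suc u , cong (false ∷_) eu
pairLevels (hi X) e = let u , eu = pairLevels X e in Fin.suc u , cong (false ∷_) eu
pairLevels (ends _ _) e = Fin.zero , refl
pairLevels (right _ X) e = ⊥-elim (ℕₚ.<⇒≢ (2≤size X) (sym (ℕₚ.suc-injective e)))
pairLevels (left X _) e = ⊥-elim (ℕₚ.<⇒≢ (2≤size X) (sym (ℕₚ.suc-injective e)))
pairLevels (fork X Y) e = ⊥-elim (ℕₚ.<⇒≢ (ℕₚ.≤-trans (ℕₚ.n≤1+n 3) (ℕₚ.+-mono-≤ (2≤size X) (2≤size Y))) (sym e))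

SubPair : Tree N → Fin N → Set
SubPair W u = Σ[ X ∈ Sub W 2 ] levels (proj₁ X) ≡ ⁅ u ⁆

-- Three points cannot fork, so they branch on two levels. Besides these, the pairs inside the
-- triple that realise each level are recorded, for use with a further point on a higher level.
record Triple (W : Tree N) : Set where
  field
    {u v}     : Fin N
    u≢v       : u ≢ v
    levels≡uv : levels W ≡ pair u v
    pairᵘ     : SubPair W u
    pairᵛ     : SubPair W v
    shape-lr  : shape W ≡ turnˡ end ⊎ shape W ≡ turnʳ end

triple : (W : Tree N) → size W ≡ 3 → Triple W
triple (lo W) e = record
  { u≢v = u≢v ∘ Finₚ.suc-injective ; levels≡uv = cong (false ∷_) levels≡uv
  ; pairᵘ = loˢ (proj₁ pairᵘ) , cong (false ∷_) (proj₂ pairᵘ)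
  ; pairᵛ = loˢ (proj₁ pairᵛ) , cong (false ∷_) (proj₂ pairᵛ)
  ; shape-lr = shape-lr }
  where open Triple (triple W e)
triple (hi W) e = record
  { u≢v = u≢v ∘ Finₚ.suc-injective ; levels≡uv = cong (false ∷_) levels≡uv
  ; pairᵘ = hiˢ (proj₁ pairᵘ) , cong (false ∷_) (proj₂ pairᵘ)
  ; pairᵛ = hiˢ (proj₁ pairᵛ) , cong (false ∷_) (proj₂ pairᵛ)
  ; shape-lr = shape-lr }
  where open Triple (triple W e)
triple (right x W) e with w , ew ← pairLevels W (ℕₚ.suc-injective e) = record
  { u = Fin.zero ; v = Fin.suc w ; u≢v = λ () ; levels≡uv = cong (true ∷_) ew
  ; pairᵘ = (_ , right-ends (proj₂ (element W)) , refl) , refl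
  ; pairᵛ = (hi W , right-hi self , ℕₚ.suc-injective e) , cong (false ∷_) ew
  ; shape-lr = inj₂ (cong turnʳ (pair-shape W (ℕₚ.suc-injective e))) }
triple (left W x) e with w , ew ← pairLevels W (ℕₚ.suc-injective e) = record
  { u = Fin.zero ; v = Fin.suc w ; u≢v = λ () ; levels≡uv = cong (true ∷_) ew
  ; pairᵘ = (_ , left-ends (proj₂ (element W)) , refl) , refl
  ; pairᵛ = (lo W , left-lo self , ℕₚ.suc-injective e) , cong (false ∷_) ew
  ; shape-lr = inj₁ (cong turnˡ (pair-shape W (ℕₚ.suc-injective e))) }
triple (fork X Y) e = ⊥-elim (ℕₚ.<⇒≢ (ℕₚ.+-mono-≤ (2≤size X) (2≤size Y)) (sym e))

-- U, V, W carry the triangle on the top level and u, v; Z has the other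
-- shape. If U and V agree, NoHook makes W differ from U and from Z.
finish : (φ : Subset (suc N) → Fin m) → NoHook φ → {S : Tree (suc N)} (U V W Z : Sub S 3) →
  ∀ {u v x y} → u ≢ v → x ≢ y →
  levels (proj₁ U) ≡ true ∷ ⁅ u ⁆ → levels (proj₁ V) ≡ true ∷ ⁅ v ⁆ → levels (proj₁ W) ≡ false ∷ pair u v →
  shapeOf U ≡ x → shapeOf V ≡ x → shapeOf Z ≡ y →
  shapeOf W ≡ x ⊎ (shapeOf W ≡ y × ∃[ w ] levels (proj₁ Z) ≡ true ∷ ⁅ w ⁆) →
  Three {A = Sub S 3} (key φ ∘ proj₁)
finish φ noHook U V W Z {u} {v} u≢v x≢y lU lV lW refl sV refl W-or
  with φ (true ∷ ⁅ u ⁆) Finₚ.≟ φ (true ∷ ⁅ v ⁆)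
... | no φu≢φv = U , V , Z ,
  (λ eq → φu≢φv (trans (cong φ (sym lU)) (trans (cong proj₂ eq) (cong φ lV)))) ,
  x≢y ∘ cong proj₁ , (λ eq → x≢y (trans (sym sV) (cong proj₁ eq)))
... | yes φu≡φv = U , W , Z , U≢W , x≢y ∘ cong proj₁ , W≢Z W-or
  where
  hook : ∀ w → φ (false ∷ pair u v) ≢ φ (true ∷ ⁅ w ⁆)
  hook w = noHook Fin.zero (Fin.suc u) (Fin.suc v) (Fin.suc w) (λ ()) (λ ()) (u≢v ∘ Finₚ.suc-injective) (λ ()) φu≡φv
  U≢W : key φ (proj₁ U) ≢ key φ (proj₁ W)
  U≢W eq = hook u (trans (cong φ (sym lW)) (trans (sym (cong proj₂ eq)) (cong φ lU)))
  W≢Z : _ → key φ (proj₁ W) ≢ key φ (proj₁ Z)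
  W≢Z (inj₁ sW) eq = x≢y (trans (sym sW) (cong proj₁ eq))
  W≢Z (inj₂ (_ , w , lZ)) eq = hook w (trans (cong φ (sym lW)) (trans (cong proj₂ eq) (cong φ lZ)))

turnˡ≢turnʳ : ∀ {x y} → turnˡ x ≢ turnʳ y
turnˡ≢turnʳ ()

noHook-suc : (φ : Subset (suc N) → C) → NoHook φ → NoHook (φ ∘ (false ∷_))
noHook-suc _ h x y z w x≢y x≢z y≢z x≢w = h (Fin.suc x) (Fin.suc y) (Fin.suc z) (Fin.suc w)
  (x≢y ∘ Finₚ.suc-injective) (x≢z ∘ Finₚ.suc-injective) (y≢z ∘ Finₚ.suc-injective) (x≢w ∘ Finₚ.suc-injective)

-- With `u` and `v` the levels of `Y`, the triangle on the top level, `u` and `v` is carried by a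
-- point of `X` with each of the two pairs of `Y`, and by `Y` itself. Both points of `X` with one of
-- `Y` turn the other way.
threeKeys-fork₂₃ : (φ : Subset (suc N) → Fin m) → NoHook φ → (X Y : Tree N) → size X ≡ 2 → size Y ≡ 3 →
  Three {A = Sub (fork X Y) 3} (key φ ∘ proj₁)
threeKeys-fork₂₃ φ noHook X Y eX eY
  with x , x∈X ← element X | y , y∈Y ← element Y | w , ew ← pairLevels X eX =
  let open Triple (triple Y eY)
      (U , i , eU) , lU = pairᵘ
      (V , j , eV) , lV = pairᵛ
  in finish φ noHook (right x U , fork-right x∈X i , cong suc eU) (right x V , fork-right x∈X j , cong suc eV)
       (hi Y , fork-hi self , eY) (left X y , fork-left self y∈Y , cong suc eX) u≢v (turnˡ≢turnʳ ∘ sym)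
       (cong (true ∷_) lU) (cong (true ∷_) lV) (cong (false ∷_) levels≡uv)
       (cong turnʳ (pair-shape U eU)) (cong turnʳ (pair-shape V eV)) (cong turnˡ (pair-shape X eX))
       ([ (λ s → inj₂ (s , w , cong (true ∷_) ew)) , inj₁ ]′ shape-lr)

threeKeys-fork₃₂ : (φ : Subset (suc N) → Fin m) → NoHook φ → (X Y : Tree N) → size X ≡ 3 → size Y ≡ 2 →
  Three {A = Sub (fork X Y) 3} (key φ ∘ proj₁)
threeKeys-fork₃₂ φ noHook X Y eX eY
  with x , x∈X ← element X | y , y∈Y ← element Y | w , ew ← pairLevels Y eY =
  let open Triple (triple X eX)
      (U , i , eU) , lU = pairᵘ
      (V , j , eV) , lV = pairᵛ
  in finish φ noHook (left U y , fork-left i y∈Y , cong suc eU) (left V y , fork-left j y∈Y , cong suc eV)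
       (lo X , fork-lo self , eX) (right x Y , fork-right x∈X self , cong suc eY) u≢v turnˡ≢turnʳ
       (cong (true ∷_) lU) (cong (true ∷_) lV) (cong (false ∷_) levels≡uv)
       (cong turnˡ (pair-shape U eU)) (cong turnˡ (pair-shape V eV)) (cong turnʳ (pair-shape Y eY))
       ([ inj₁ , (λ s → inj₂ (s , w , cong (true ∷_) ew)) ]′ shape-lr)

-- Below a lone point there are four points with a fork. A triple `W` of them that turns to the same
-- side as the lone point does carries the triangle together with it, and a triple turning the other
-- way serves as `Z`.
threeKeys₅ : (φ : Subset N → Fin m) → NoHook φ → {S : Tree N} → Forked S → size S ≡ 5 →
  Three {A = Sub S 3} (key φ ∘ proj₁)
threeKeys₅ φ noHook (lo f) e = mapThree loˢ (λ _ _ eq → eq) (threeKeys₅ (φ ∘ (false ∷_)) (noHook-suc φ noHook) f e)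
threeKeys₅ φ noHook (hi f) e = mapThree hiˢ (λ _ _ eq → eq) (threeKeys₅ (φ ∘ (false ∷_)) (noHook-suc φ noHook) f e)
threeKeys₅ φ noHook (right {p = p} f) e
  with W , w ← rightTriple f | Z , z ← leftTriple f =
  let open Triple (triple (proj₁ W) (proj₂ (proj₂ W)))
      U , eU = pairᵘ
      V , eV = pairᵛ
  in finish φ noHook (rightˢ p (transˢ W U)) (rightˢ p (transˢ W V)) (right-hiˢ p W) (right-hiˢ p Z)
       u≢v (turnˡ≢turnʳ ∘ sym)
       (cong (true ∷_) eU) (cong (true ∷_) eV) (cong (false ∷_) levels≡uv)
       (cong turnʳ (pair-shape (proj₁ U) (proj₂ (proj₂ U)))) (cong turnʳ (pair-shape (proj₁ V) (proj₂ (proj₂ V)))) z (inj₁ w)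
threeKeys₅ φ noHook (left {p = p} f) e
  with W , w ← leftTriple f | Z , z ← rightTriple f =
  let open Triple (triple (proj₁ W) (proj₂ (proj₂ W)))
      U , eU = pairᵘ
      V , eV = pairᵛ
  in finish φ noHook (leftˢ p (transˢ W U)) (leftˢ p (transˢ W V)) (left-loˢ p W) (left-loˢ p Z)
       u≢v turnˡ≢turnʳ
       (cong (true ∷_) eU) (cong (true ∷_) eV) (cong (false ∷_) levels≡uv)
       (cong turnˡ (pair-shape (proj₁ U) (proj₂ (proj₂ U)))) (cong turnˡ (pair-shape (proj₁ V) (proj₂ (proj₂ V)))) z (inj₁ w)
threeKeys₅ φ noHook (fork {X = X} {Y}) e
  with ℕₚ.m≤n⇒∃[o]m+o≡n (2≤size X) | ℕₚ.m≤n⇒∃[o]m+o≡n (2≤size Y)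
... | zero , eX | _ =
  threeKeys-fork₂₃ φ noHook X Y (sym eX) (ℕₚ.+-cancelˡ-≡ 2 _ _ (trans (cong (_+ size Y) eX) e))
... | suc a , _ | zero , eY =
  threeKeys-fork₃₂ φ noHook X Y (ℕₚ.+-cancelʳ-≡ 2 _ _ (trans (cong (size X +_) eY) e)) (sym eY)
... | suc a , eX | suc b , eY =
  ⊥-elim (ℕₚ.<⇒≢ (ℕₚ.+-mono-≤ (subst (3 ≤_) eX (ℕₚ.m≤m+n 3 a)) (subst (3 ≤_) eY (ℕₚ.m≤m+n 3 b))) (sym e))

-- Subsets of the cube as bit vectors

data Family (N : ℕ) : Set where
  empty : Family N
  point : Point N → Family N
  tree  : Tree N → Family N

node : Family N → Family N → Family (suc N)
node empty     empty     = empty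
node empty     (point q) = point (true ∷ q)
node empty     (tree Y)  = tree (hi Y)
node (point p) empty     = point (false ∷ p)
node (point p) (point q) = tree (ends p q)
node (point p) (tree Y)  = tree (right p Y)
node (tree X)  empty     = tree (lo X)
node (tree X)  (point q) = tree (left X q)
node (tree X)  (tree Y)  = tree (fork X Y)

parse : ∀ N → Subset (cube N) → Family N
parse zero    (false ∷ []) = empty
parse zero    (true ∷ [])  = point []
parse (suc N) S            = node (parse N (take (cube N) S)) (parse N (drop (cube N) S))

flatᵖ : Point N → Subset (cube N)
flatᵖ []          = true ∷ []
flatᵖ (false ∷ p) = flatᵖ p ++ ∅
flatᵖ (_∷_ {N} true p) = ∅ {cube N} ++ flatᵖ p

flat : Tree N → Subset (cube N)
flat (lo X)      = flat X ++ ∅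
flat (hi {N} X)  = ∅ {cube N} ++ flat X
flat (ends p q)  = flatᵖ p ++ flatᵖ q
flat (right p X) = flatᵖ p ++ flat X
flat (left X p)  = flat X ++ flatᵖ p
flat (fork X Y)  = flat X ++ flat Y

flatᶠ : Family N → Subset (cube N)
flatᶠ empty     = ∅
flatᶠ (point p) = flatᵖ p
flatᶠ (tree X)  = flat X

∅++∅ : ∀ m {n} → ∅ {m} ++ ∅ {n} ≡ ∅
∅++∅ zero    = refl
∅++∅ (suc m) = cong (false ∷_) (∅++∅ m)

flat-node : (f g : Family N) → flatᶠ (node f g) ≡ flatᶠ f ++ flatᶠ g
flat-node {N} empty empty   = sym (∅++∅ (cube N))
flat-node empty     (point _) = refl
flat-node empty     (tree _)  = refl
flat-node (point _) empty     = refl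
flat-node (point _) (point _) = refl
flat-node (point _) (tree _)  = refl
flat-node (tree _)  empty     = refl
flat-node (tree _)  (point _) = refl
flat-node (tree _)  (tree _)  = refl

flat-parse : ∀ N (S : Subset (cube N)) → flatᶠ (parse N S) ≡ S
flat-parse zero    (false ∷ []) = refl
flat-parse zero    (true ∷ [])  = refl
flat-parse (suc N) S =
  trans (flat-node (parse N (take (cube N) S)) _)
    (trans (cong₂ _++_ (flat-parse N (take (cube N) S)) (flat-parse N (drop (cube N) S)))
             (take++drop≡id (cube N) S))

∣++∣ : (E : Subset m) (F : Subset n) → ∣ E ++ F ∣ ≡ ∣ E ∣ + ∣ F ∣
∣++∣ []          F = refl
∣++∣ (true ∷ E)  F = cong suc (∣++∣ E F)
∣++∣ (false ∷ E) F = ∣++∣ E F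

∣flatᵖ∣ : (p : Point N) → ∣ flatᵖ p ∣ ≡ 1
∣flatᵖ∣ [] = refl
∣flatᵖ∣ (_∷_ {N} false p) = trans (∣++∣ (flatᵖ p) ∅) (cong₂ _+_ (∣flatᵖ∣ p) (∣⊥∣≡0 (cube N)))
∣flatᵖ∣ (_∷_ {N} true p) = trans (∣++∣ (∅ {cube N}) (flatᵖ p)) (cong₂ _+_ (∣⊥∣≡0 (cube N)) (∣flatᵖ∣ p))

∣flat∣ : (X : Tree N) → ∣ flat X ∣ ≡ size X
∣flat∣ (lo {N} X)  = trans (∣++∣ (flat X) ∅) (trans (cong₂ _+_ (∣flat∣ X) (∣⊥∣≡0 (cube N))) (ℕₚ.+-identityʳ _))
∣flat∣ (hi {N} X)  = trans (∣++∣ (∅ {cube N}) (flat X)) (cong₂ _+_ (∣⊥∣≡0 (cube N)) (∣flat∣ X))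
∣flat∣ (ends p q)  = trans (∣++∣ (flatᵖ p) (flatᵖ q)) (cong₂ _+_ (∣flatᵖ∣ p) (∣flatᵖ∣ q))
∣flat∣ (right p X) = trans (∣++∣ (flatᵖ p) (flat X)) (cong₂ _+_ (∣flatᵖ∣ p) (∣flat∣ X))
∣flat∣ (left X p)  = trans (∣++∣ (flat X) (flatᵖ p)) (trans (cong₂ _+_ (∣flat∣ X) (∣flatᵖ∣ p)) (ℕₚ.+-comm _ 1))
∣flat∣ (fork X Y)  = trans (∣++∣ (flat X) (flat Y)) (cong₂ _+_ (∣flat∣ X) (∣flat∣ Y))

++-unique : (A : Subset m) (B : Subset n) → take m (A ++ B) ≡ A × drop m (A ++ B) ≡ B
++-unique {m} A B =
  ++-injectiveˡ _ _ (take++drop≡id m (A ++ B)) , ++-injectiveʳ (take m (A ++ B)) A (take++drop≡id m (A ++ B))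

parse-++ : (A B : Subset (cube N)) → parse (suc N) (A ++ B) ≡ node (parse N A) (parse N B)
parse-++ {N} A B = cong₂ (λ A B → node (parse N A) (parse N B)) (proj₁ (++-unique A B)) (proj₂ (++-unique A B))

parse-∅ : ∀ N → parse N ∅ ≡ empty
parse-∅ zero    = refl
parse-∅ (suc N) = trans (cong (parse (suc N)) (sym (∅++∅ (cube N))))
  (trans (parse-++ {N} ∅ ∅) (cong₂ node (parse-∅ N) (parse-∅ N)))

parse-flatᵖ : (p : Point N) → parse N (flatᵖ p) ≡ point p
parse-flatᵖ [] = refl
parse-flatᵖ (_∷_ {N} false p) = trans (parse-++ (flatᵖ p) ∅) (cong₂ node (parse-flatᵖ p) (parse-∅ N))
parse-flatᵖ (_∷_ {N} true p)  = trans (parse-++ {N} ∅ (flatᵖ p)) (cong₂ node (parse-∅ N) (parse-flatᵖ p))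

parse-flat : (X : Tree N) → parse N (flat X) ≡ tree X
parse-flat (lo {N} X)  = trans (parse-++ (flat X) ∅) (cong₂ node (parse-flat X) (parse-∅ N))
parse-flat (hi {N} X)  = trans (parse-++ {N} ∅ (flat X)) (cong₂ node (parse-∅ N) (parse-flat X))
parse-flat (ends p q)  = trans (parse-++ (flatᵖ p) (flatᵖ q)) (cong₂ node (parse-flatᵖ p) (parse-flatᵖ q))
parse-flat (right p X) = trans (parse-++ (flatᵖ p) (flat X)) (cong₂ node (parse-flatᵖ p) (parse-flat X))
parse-flat (left X p)  = trans (parse-++ (flat X) (flatᵖ p)) (cong₂ node (parse-flat X) (parse-flatᵖ p))
parse-flat (fork X Y)  = trans (parse-++ (flat X) (flat Y)) (cong₂ node (parse-flat X) (parse-flat Y))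

≤ˢ-refl : {E : Subset n} → E ≤ˢ E
≤ˢ-refl = Pointwise.refl b≤b

≤ˢ-trans : {E F G : Subset n} → E ≤ˢ F → F ≤ˢ G → E ≤ˢ G
≤ˢ-trans = Pointwise.trans Boolₚ.≤-trans

∅≤ˢ : (E : Subset n) → ∅ ≤ˢ E
∅≤ˢ []      = []
∅≤ˢ (b ∷ E) = Boolₚ.≤-minimum b ∷ ∅≤ˢ E

∈⇒≤ˢ : ∀ {p} {X : Tree N} → p ∈ᵗ X → flatᵖ p ≤ˢ flat X
∈⇒≤ˢ (lo i)     = ++⁺ (∈⇒≤ˢ i) ≤ˢ-refl
∈⇒≤ˢ (hi {N} i) = ++⁺ (≤ˢ-refl {cube N}) (∈⇒≤ˢ i)
∈⇒≤ˢ (ends₀ {p = p} {q}) = ++⁺ (≤ˢ-refl {E = flatᵖ p}) (∅≤ˢ (flatᵖ q))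
∈⇒≤ˢ (ends₁ {p = p} {q}) = ++⁺ (∅≤ˢ (flatᵖ p)) (≤ˢ-refl {E = flatᵖ q})
∈⇒≤ˢ (right₀ {p = p} {X}) = ++⁺ (≤ˢ-refl {E = flatᵖ p}) (∅≤ˢ (flat X))
∈⇒≤ˢ (right₁ i) = ++⁺ (∅≤ˢ _) (∈⇒≤ˢ i)
∈⇒≤ˢ (left₀ i)  = ++⁺ (∈⇒≤ˢ i) (∅≤ˢ _)
∈⇒≤ˢ (left₁ {p = p} {X}) = ++⁺ (∅≤ˢ (flat X)) (≤ˢ-refl {E = flatᵖ p})
∈⇒≤ˢ (fork₀ i)  = ++⁺ (∈⇒≤ˢ i) (∅≤ˢ _)
∈⇒≤ˢ (fork₁ i)  = ++⁺ (∅≤ˢ _) (∈⇒≤ˢ i)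

⊑⇒≤ˢ : {X Y : Tree N} → X ⊑ Y → flat X ≤ˢ flat Y
⊑⇒≤ˢ self             = ≤ˢ-refl
⊑⇒≤ˢ (⊑-trans i j)    = ≤ˢ-trans (⊑⇒≤ˢ i) (⊑⇒≤ˢ j)
⊑⇒≤ˢ (lo i)           = ++⁺ (⊑⇒≤ˢ i) ≤ˢ-refl
⊑⇒≤ˢ (hi {N} i)       = ++⁺ (≤ˢ-refl {cube N}) (⊑⇒≤ˢ i)
⊑⇒≤ˢ (right i)        = ++⁺ ≤ˢ-refl (⊑⇒≤ˢ i)
⊑⇒≤ˢ (right-ends i)   = ++⁺ ≤ˢ-refl (∈⇒≤ˢ i)
⊑⇒≤ˢ (right-hi i)     = ++⁺ (∅≤ˢ _) (⊑⇒≤ˢ i)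
⊑⇒≤ˢ (left i)         = ++⁺ (⊑⇒≤ˢ i) ≤ˢ-refl
⊑⇒≤ˢ (left-ends i)    = ++⁺ (∈⇒≤ˢ i) ≤ˢ-refl
⊑⇒≤ˢ (left-lo i)      = ++⁺ (⊑⇒≤ˢ i) (∅≤ˢ _)
⊑⇒≤ˢ (fork i j)       = ++⁺ (⊑⇒≤ˢ i) (⊑⇒≤ˢ j)
⊑⇒≤ˢ (fork-right i j) = ++⁺ (∈⇒≤ˢ i) (⊑⇒≤ˢ j)
⊑⇒≤ˢ (fork-left i j)  = ++⁺ (⊑⇒≤ˢ i) (∈⇒≤ˢ j)
⊑⇒≤ˢ (fork-lo i)      = ++⁺ (⊑⇒≤ˢ i) (∅≤ˢ _)
⊑⇒≤ˢ (fork-hi i)      = ++⁺ (∅≤ˢ _) (⊑⇒≤ˢ i)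

parse-tree : (S : Subset (cube N)) → 2 ≤ ∣ S ∣ → ∃[ X ] flat X ≡ S
parse-tree {N} S 2≤ with parse N S | flat-parse N S
... | empty   | refl = ⊥-elim (ℕₚ.<⇒≢ (ℕₚ.<-trans (s≤s z≤n) 2≤) (sym (∣⊥∣≡0 (cube N))))
... | point p | refl = ⊥-elim (ℕₚ.<⇒≢ 2≤ (sym (∣flatᵖ∣ p)))
... | tree X  | e    = X , e

record TreeGood (k : ℕ) (χ : Tree N → C) : Set where
  field
    two   : ∀ S → size S ≡ 1 + k → Two {A = Sub S k} (χ ∘ proj₁)
    three : ∀ S → size S ≡ 2 + k → Three {A = Sub S k} (χ ∘ proj₁)

module _ (χ : Tree N → C) (c₀ : C) where

  flatColor : Subset (cube N) → C
  flatColor S with parse N S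
  ... | tree X = χ X
  -- A default for sets with fewer than two points, which are not trees.
  ... | _      = c₀

  flatColor-flat : ∀ X → flatColor (flat X) ≡ χ X
  flatColor-flat X rewrite parse-flat X = refl

  flatGood : TreeGood (suc k) χ → Good (suc k) flatColor
  flatGood {k} good = record
    { two   = λ S e → let X , eX = parse-tree S (subst (2 ≤_) (sym e) (s≤s (s≤s z≤n)))
                      in subst (λ S → Two {A = Subsets S (suc k)} _) eX
                           (mapTwo (flatˢ {X}) reflects (two X (sizes X eX e)))
    ; three = λ S e → let X , eX = parse-tree S (subst (2 ≤_) (sym e) (s≤s (s≤s z≤n)))
                      in subst (λ S → Three {A = Subsets S (suc k)} _) eX
                           (mapThree (flatˢ {X}) reflects (three X (sizes X eX e)))
    }
    where
    open TreeGood good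
    sizes : ∀ X {S} → flat X ≡ S → ∀ {s} → ∣ S ∣ ≡ s → size X ≡ s
    sizes X refl e = trans (sym (∣flat∣ X)) e
    flatˢ : ∀ {X} → Sub X (suc k) → Subsets (flat X) (suc k)
    flatˢ (Y , i , e) = flat Y , ⊑⇒≤ˢ i , trans (∣flat∣ Y) e
    reflects : ∀ {X} (Y Z : Sub X (suc k)) → 
      flatColor (flat (proj₁ Y)) ≡ flatColor (flat (proj₁ Z)) → χ (proj₁ Y) ≡ χ (proj₁ Z)
    reflects (Y , _) (Z , _) e = trans (sym (flatColor-flat Y)) (trans e (flatColor-flat Z))

-- Stepping up

-- Base-three digits, least significant first: 1 and 2 are turns, and remainder 0 ends the word,
-- with value 0 for `end` and a positive multiple of 3 for `stop`.
code : Shape → ℕ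
code end      = 0
code (stop a) = suc a * 3
code (turnˡ x)    = 1 + code x * 3
code (turnʳ x)    = 2 + code x * 3

3n≢1+3n : ∀ m n → m * 3 ≢ 1 + n * 3
3n≢1+3n (suc m) (suc n) e = 3n≢1+3n m n (ℕₚ.+-cancelˡ-≡ 3 _ _ e)

3n≢2+3n : ∀ m n → m * 3 ≢ 2 + n * 3
3n≢2+3n (suc m) (suc n) e = 3n≢2+3n m n (ℕₚ.+-cancelˡ-≡ 3 _ _ e)

code-injective : ∀ x y → code x ≡ code y → x ≡ y
code-injective end      end      _ = refl
code-injective end      (turnˡ y)    ()
code-injective (turnˡ x)    end      ()
code-injective (stop a) (stop b) e = cong stop (ℕₚ.suc-injective (ℕₚ.*-cancelʳ-≡ (suc a) (suc b) 3 e))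
code-injective (stop a) (turnˡ y)    e = ⊥-elim (3n≢1+3n (suc a) (code y) e)
code-injective (stop a) (turnʳ y)    e = ⊥-elim (3n≢2+3n (suc a) (code y) e)
code-injective (turnˡ x)    (stop b) e = ⊥-elim (3n≢1+3n (suc b) (code x) (sym e))
code-injective (turnˡ x)    (turnˡ y)    e = cong turnˡ (code-injective x y (ℕₚ.*-cancelʳ-≡ _ _ 3 (ℕₚ.suc-injective e)))
code-injective (turnˡ x)    (turnʳ y)    e = ⊥-elim (3n≢1+3n (code x) (code y) (ℕₚ.suc-injective e))
code-injective (turnʳ x)    (stop b) e = ⊥-elim (3n≢2+3n (suc b) (code x) (sym e))
code-injective (turnʳ x)    (turnˡ y)    e = ⊥-elim (3n≢1+3n (code y) (code x) (ℕₚ.suc-injective (sym e)))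
code-injective (turnʳ x)    (turnʳ y)    e =
  cong turnʳ (code-injective x y (ℕₚ.*-cancelʳ-≡ _ _ 3 (ℕₚ.suc-injective (ℕₚ.suc-injective e))))

n<3^n : ∀ n → n ℕ.< 3 ^ n
n<3^n zero    = s≤s z≤n
n<3^n (suc n) = ℕₚ.≤-trans (ℕₚ.+-mono-≤ (ℕₚ.m^n>0 3 n) (n<3^n n)) (ℕₚ.+-monoʳ-≤ (3 ^ n) (ℕₚ.m≤m+n _ _))

3-step : ∀ {m} n → m ℕ.< 3 ^ n → suc m * 3 ≤ 3 ^ suc n
3-step n lt = ℕₚ.≤-trans (ℕₚ.*-monoˡ-≤ 3 lt) (ℕₚ.≤-reflexive (ℕₚ.*-comm (3 ^ n) 3))

-- A turn uses up one point and one base-three digit. At a fork the right side has at least two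
-- points, and `3 (1 + a) < 3^(a + 2)`.
code-bound : (X : Tree N) → code (shape X) ℕ.< 3 ^ size X
code-bound (lo X)      = code-bound X
code-bound (hi X)      = code-bound X
code-bound (ends _ _)  = s≤s z≤n
code-bound (right _ X) = 3-step (size X) (code-bound X)
code-bound (left X _)  = ℕₚ.≤-trans (ℕₚ.n≤1+n _) (3-step (size X) (code-bound X))
code-bound (fork X Y)  = ℕₚ.≤-trans (ℕₚ.m≤n+m _ 2) (ℕₚ.≤-trans (3-step (suc (size X)) (n<3^n (suc (size X))))
  (ℕₚ.^-monoʳ-≤ 3 (ℕₚ.≤-trans (ℕₚ.≤-reflexive (ℕₚ.+-comm 2 (size X))) (ℕₚ.+-monoʳ-≤ (size X) (2≤size Y)))))

-- Reduction modulo `3 ^ k` makes this total; on the codes of trees with `k` points it is injective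
-- by `code-bound`.
digit : ∀ k → ℕ → Fin (3 ^ k)
digit k x = _mod_ x (3 ^ k) {{ℕₚ.m^n≢0 3 k}}

toℕ-digit : ∀ k {x} → x ℕ.< 3 ^ k → toℕ (digit k x) ≡ x
toℕ-digit k {x} lt = trans (Finₚ.toℕ-fromℕ< (m%n<n x (3 ^ k) {{ℕₚ.m^n≢0 3 k}})) (m<n⇒m%n≡m {{ℕₚ.m^n≢0 3 k}} lt)

digit-injective : ∀ k {x y} → x ℕ.< 3 ^ k → y ℕ.< 3 ^ k → digit k x ≡ digit k y → x ≡ y
digit-injective k p q e = trans (sym (toℕ-digit k p)) (trans (cong toℕ e) (toℕ-digit k q))

color : ∀ k → (Subset N → Fin m) → Tree N → Fin (3 ^ k * m)
color k φ X = combine (digit k (code (shape X))) (φ (levels X))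

color-key : (φ : Subset N → Fin m) {S : Tree N} (X Y : Sub S k) →
  color k φ (proj₁ X) ≡ color k φ (proj₁ Y) → key φ (proj₁ X) ≡ key φ (proj₁ Y)
color-key φ (X , _ , refl) (Y , _ , eY) e =
  let e₁ , e₂ = Finₚ.combine-injective _ _ _ _ e
  in cong₂ _,_ (code-injective _ _
       (digit-injective (size X) (code-bound X) (subst (λ s → _ ℕ.< 3 ^ s) eY (code-bound Y)) e₁)) e₂

Colorable : ℕ → ℕ → ℕ → Set
Colorable n k m = Σ[ φ ∈ (Subset n → Fin m) ] Good k φ

module _ {n m : ℕ} (φ : Subset n → Fin m)
  (two : ∀ {S : Tree n} → size S ≡ 3 + k → Two {A = Sub S (2 + k)} (key φ ∘ proj₁))
  (three : ∀ {S : Tree n} → size S ≡ 4 + k → Three {A = Sub S (2 + k)} (key φ ∘ proj₁)) where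

  colorableFromKeys : Colorable (cube n) (2 + k) (3 ^ (2 + k) * m)
  colorableFromKeys = _ , flatGood (color (2 + k) φ) (combine (digit (2 + k) 0) (φ ∅)) record
    { two   = λ S e → mapTwo (λ X → X) (λ X Y → color-key φ X Y) (two e)
    ; three = λ S e → mapThree (λ X → X) (color-key φ) (three e)
    }

stepUp : 3 ≤ k → Colorable n k m → Colorable (cube n) (suc k) (3 ^ suc k * m)
stepUp {k = suc k} (s≤s 2≤k) (φ , good) =
  colorableFromKeys φ (λ {S} → twoKeys good {S}) (threeKeys good 2≤k)

-- From graph colourings without hooks to triples

enumerate : (S : Subset n) → ∣ S ∣ ≡ s →
  Σ[ f ∈ (Fin s → Fin n) ] (∀ {i j} → f i ≡ f j → i ≡ j) × (∀ i → f i ∈ S)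
enumerate [] refl = (λ ()) , (λ { {()} }) , λ ()
enumerate (false ∷ S) e = let f , inj , mem = enumerate S e in Fin.suc ∘ f , inj ∘ Finₚ.suc-injective , there ∘ mem
enumerate {s = suc s} (true ∷ S) e =
  let f , inj , mem = enumerate S (ℕₚ.suc-injective e)
  in (λ { Fin.zero → Fin.zero ; (Fin.suc i) → Fin.suc (f i) }) ,
     (λ { {Fin.zero} {Fin.zero} _ → refl ; {Fin.suc i} {Fin.suc j} e → cong Fin.suc (inj (Finₚ.suc-injective e)) }) ,
     λ { Fin.zero → here ; (Fin.suc i) → there (mem i) }

⁅⁆≤ˢ : ∀ {x} {S : Subset n} → x ∈ S → ⁅ x ⁆ ≤ˢ S
⁅⁆≤ˢ {S = true ∷ S} here = b≤b ∷ ∅≤ˢ S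
⁅⁆≤ˢ {S = b ∷ S} (there i) = Boolₚ.≤-minimum b ∷ ⁅⁆≤ˢ i

pair≤ˢ : ∀ {x y} {S : Subset n} → x ∈ S → y ∈ S → pair x y ≤ˢ S
pair≤ˢ {S = true ∷ S} here      here      = b≤b ∷ ∅≤ˢ S
pair≤ˢ here      (there j) = b≤b ∷ ⁅⁆≤ˢ j
pair≤ˢ (there i) here      = b≤b ∷ ⁅⁆≤ˢ i
pair≤ˢ {S = b ∷ S} (there i) (there j) = Boolₚ.≤-minimum b ∷ pair≤ˢ i j

∣pair∣ : ∀ {x y : Fin n} → x ≢ y → ∣ pair x y ∣ ≡ 2
∣pair∣ {x = Fin.zero}  {Fin.zero}  x≢y = ⊥-elim (x≢y refl)
∣pair∣ {x = Fin.zero}  {Fin.suc y} _   = cong suc (∣⁅x⁆∣≡1 y)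
∣pair∣ {x = Fin.suc x} {Fin.zero}  _   = cong suc (∣⁅x⁆∣≡1 x)
∣pair∣ {x = Fin.suc x} {Fin.suc y} x≢y = ∣pair∣ (x≢y ∘ cong Fin.suc)

module _ (φ : Subset n → Fin m) (noHook : NoHook φ) where

  private
    module Vertices {S : Subset n} (f : Fin s → Fin n) 
      (inj : ∀ {i j} → f i ≡ f j → i ≡ j) (mem : ∀ i → f i ∈ S) where

      c : Fin s → Fin s → Fin m
      c i j = φ (pair (f i) (f j))

      edge : (i j : Fin s) → i ≢ j → Subsets S 2
      edge i j i≢j = pair (f i) (f j) , pair≤ˢ (mem i) (mem j) , ∣pair∣ (i≢j ∘ inj)

      hook : ∀ {x y z} w → x ≢ y → x ≢ z → y ≢ z → x ≢ w → c x y ≡ c x z → c y z ≢ c x w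
      hook w x≢y x≢z y≢z x≢w = noHook _ _ _ _ (x≢y ∘ inj) (x≢z ∘ inj) (y≢z ∘ inj) (x≢w ∘ inj)

      K₃ : ∀ {x y z} → x ≢ y → x ≢ z → y ≢ z → Two {A = Subsets S 2} (φ ∘ proj₁)
      K₃ {x} {y} {z} x≢y x≢z y≢z with c x y Finₚ.≟ c x z
      ... | no  xy≢xz = edge x y x≢y , edge x z x≢z , xy≢xz
      ... | yes xy≡xz = edge x y x≢y , edge y z y≢z , hook y x≢y x≢z y≢z x≢y xy≡xz ∘ sym

      -- As `xy` and `xz` agree, the colour of `yz` differs from that of every edge at `x`. The
      -- third colour is that of `xw`, unless the star at `x` is monochromatic; then no edge of the
      -- triangle `yzw` has the colour of the star, and the triangle itself has two colours.
      K₄-claw : ∀ {x y z w} → x ≢ y → x ≢ z → x ≢ w → y ≢ z → y ≢ w → z ≢ w →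
        c x y ≡ c x z → Three {A = Subsets S 2} (φ ∘ proj₁)
      K₄-claw {x} {y} {z} {w} x≢y x≢z x≢w y≢z y≢w z≢w xy≡xz with c x w Finₚ.≟ c x y
      ... | no xw≢xy = edge x y x≢y , edge y z y≢z , edge x w x≢w ,
        hook y x≢y x≢z y≢z x≢y xy≡xz ∘ sym , xw≢xy ∘ sym , hook w x≢y x≢z y≢z x≢w xy≡xz
      ... | yes xw≡xy with c y z Finₚ.≟ c y w
      ... | no yz≢yw = edge x y x≢y , edge y z y≢z , edge y w y≢w ,
        hook y x≢y x≢z y≢z x≢y xy≡xz ∘ sym , hook y x≢y x≢w y≢w x≢y (sym xw≡xy) ∘ sym , yz≢yw
      ... | yes yz≡yw = edge x y x≢y , edge y z y≢z , edge z w z≢w ,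
        hook y x≢y x≢z y≢z x≢y xy≡xz ∘ sym , hook y x≢z x≢w z≢w x≢y (trans (sym xy≡xz) (sym xw≡xy)) ∘ sym ,
        hook z y≢z y≢w z≢w y≢z yz≡yw ∘ sym

      K₄ : ∀ {x y z w} → x ≢ y → x ≢ z → x ≢ w → y ≢ z → y ≢ w → z ≢ w → Three {A = Subsets S 2} (φ ∘ proj₁)
      K₄ {x} {y} {z} {w} x≢y x≢z x≢w y≢z y≢w z≢w
        with c x y Finₚ.≟ c x z | c x y Finₚ.≟ c x w | c x z Finₚ.≟ c x w
      ... | yes e | _ | _ = K₄-claw x≢y x≢z x≢w y≢z y≢w z≢w e
      ... | no _ | yes e | _ = K₄-claw x≢y x≢w x≢z y≢w y≢z (z≢w ∘ sym) e
      ... | no _ | no _ | yes e = K₄-claw x≢z x≢w x≢y z≢w (y≢z ∘ sym) (y≢w ∘ sym) e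
      ... | no xy≢xz | no xy≢xw | no xz≢xw = edge x y x≢y , edge x z x≢z , edge x w x≢w , xy≢xz , xy≢xw , xz≢xw

  noHook⇒good : Good 2 φ
  noHook⇒good = record { two = two ; three = three }
    where
    two : ∀ S → ∣ S ∣ ≡ 3 → Two {A = Subsets S 2} (φ ∘ proj₁)
    two S e with f , inj , mem ← enumerate S e =
      Vertices.K₃ f inj mem {Fin.zero} {Fin.suc Fin.zero} {Fin.suc (Fin.suc Fin.zero)} (λ ()) (λ ()) (λ ())
    three : ∀ S → ∣ S ∣ ≡ 4 → Three {A = Subsets S 2} (φ ∘ proj₁)
    three S e with f , inj , mem ← enumerate S e =
      Vertices.K₄ f inj mem {Fin.zero} {Fin.suc Fin.zero} {Fin.suc (Fin.suc Fin.zero)}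
        {Fin.suc (Fin.suc (Fin.suc Fin.zero))}
        (λ ()) (λ ()) (λ ()) (λ ()) (λ ()) (λ ())

  colorable₃ : Colorable (cube n) 3 (3 ^ 3 * m)
  colorable₃ = colorableFromKeys φ (λ {S} → twoKeys noHook⇒good {S}) three
    where
    three : ∀ {S : Tree n} → size S ≡ 5 → Three {A = Sub S 3} (key φ ∘ proj₁)
    three {S} e with cat⊎forked S
    ... | inj₁ c = threeKeys-cat noHook⇒good c e
    ... | inj₂ f = threeKeys₅ φ noHook f e

-- The graph colouring

pointColor : (Fin n → C) → C → Subset n → C
pointColor f d []          = d
pointColor f d (true ∷ _)  = f Fin.zero
pointColor f d (false ∷ S) = pointColor (f ∘ Fin.suc) d S

-- The first two elements of the set determine the colour; `d` is the default when there are fewer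
-- than two.
pairColor : (Fin n → Fin n → C) → C → Subset n → C
pairColor c d []          = d
pairColor c d (true ∷ S)  = pointColor (c Fin.zero ∘ Fin.suc) d S
pairColor c d (false ∷ S) = pairColor (λ x y → c (Fin.suc x) (Fin.suc y)) d S

pointColor-⁅⁆ : (f : Fin n → C) (d : C) (x : Fin n) → pointColor f d ⁅ x ⁆ ≡ f x
pointColor-⁅⁆ f d Fin.zero    = refl
pointColor-⁅⁆ f d (Fin.suc x) = pointColor-⁅⁆ (f ∘ Fin.suc) d x

pairColor-pair : (c : Fin n → Fin n → C) (d : C) → (∀ x y → c x y ≡ c y x) →
  ∀ {x y} → x ≢ y → pairColor c d (pair x y) ≡ c x y
pairColor-pair c d sy {Fin.zero}  {Fin.zero}  x≢y = ⊥-elim (x≢y refl)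
pairColor-pair c d sy {Fin.zero}  {Fin.suc y} _   = pointColor-⁅⁆ _ d y
pairColor-pair c d sy {Fin.suc x} {Fin.zero}  _   = trans (pointColor-⁅⁆ _ d x) (sy _ _)
pairColor-pair c d sy {Fin.suc x} {Fin.suc y} x≢y =
  pairColor-pair _ d (λ x y → sy (Fin.suc x) (Fin.suc y)) (x≢y ∘ cong Fin.suc)

unordered : Fin b → Fin b → Fin (b * b)
unordered u v with u Finₚ.≤? v
... | yes _ = combine u v
... | no  _ = combine v u

unordered-comm : (u v : Fin b) → unordered u v ≡ unordered v u
unordered-comm u v with u Finₚ.≤? v | v Finₚ.≤? u
... | yes p | yes q with refl ← Finₚ.≤-antisym p q = refl
... | yes _ | no _  = refl
... | no _  | yes _ = refl
... | no p  | no q  = ⊥-elim (p (ℕₚ.<⇒≤ (ℕₚ.≰⇒> q)))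

unordered-injective : (u v u′ v′ : Fin b) → unordered u v ≡ unordered u′ v′ → u′ ≡ u ⊎ u′ ≡ v
unordered-injective u v u′ v′ e with u Finₚ.≤? v | u′ Finₚ.≤? v′
... | yes _ | yes _ = inj₁ (sym (proj₁ (Finₚ.combine-injective u v u′ v′ e)))
... | yes _ | no _  = inj₂ (sym (proj₂ (Finₚ.combine-injective u v v′ u′ e)))
... | no _  | yes _ = inj₂ (sym (proj₁ (Finₚ.combine-injective v u u′ v′ e)))
... | no _  | no _  = inj₁ (sym (proj₂ (Finₚ.combine-injective v u v′ u′ e)))

bit : Dec A → Fin 2
bit (yes _) = Fin.zero
bit (no _)  = Fin.suc Fin.zero

bit-transfer : (p : Dec A) (q : Dec B) → bit p ≡ bit q → A → B
bit-transfer (yes _) (yes b) _ _ = b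
bit-transfer (no ¬a) _       _ a = ⊥-elim (¬a a)

bit-cong : (p : Dec A) (q : Dec B) → (A → B) → (B → A) → bit p ≡ bit q
bit-cong (yes _) (yes _) _ _ = refl
bit-cong (yes a) (no ¬b) f _ = ⊥-elim (¬b (f a))
bit-cong (no ¬a) (yes b) _ g = ⊥-elim (¬a (g b))
bit-cong (no _)  (no _)  _ _ = refl

firstPair : ∀ t → (f g : Fin (suc t) → Fin b) → Fin (b * b)
-- At the last coordinate no test is made; for equal tuples this serves as a default.
firstPair zero    f g = unordered (f Fin.zero) (g Fin.zero)
firstPair (suc t) f g with f Fin.zero Finₚ.≟ g Fin.zero
... | yes _ = firstPair t (f ∘ Fin.suc) (g ∘ Fin.suc)
... | no _  = unordered (f Fin.zero) (g Fin.zero)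

firstPair-comm : ∀ t (f g : Fin (suc t) → Fin b) → firstPair t f g ≡ firstPair t g f
firstPair-comm zero f g = unordered-comm (f Fin.zero) (g Fin.zero)
firstPair-comm (suc t) f g with f Fin.zero Finₚ.≟ g Fin.zero | g Fin.zero Finₚ.≟ f Fin.zero
... | yes _ | yes _ = firstPair-comm t _ _
... | yes e | no ne = ⊥-elim (ne (sym e))
... | no ne | yes e = ⊥-elim (ne (sym e))
... | no _  | no _  = unordered-comm (f Fin.zero) (g Fin.zero)

-- Equal agreement sets have the same first coordinate outside them, so both unordered pairs are
-- read off at one index.
firstPair-index : ∀ t (f g f′ g′ : Fin (suc t) → Fin b) →
  (∀ i → f i ≡ g i → f′ i ≡ g′ i) → (∀ i → f′ i ≡ g′ i → f i ≡ g i) → ∃[ i ] f i ≢ g i →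
  ∃[ i ] f i ≢ g i × firstPair t f g ≡ unordered (f i) (g i) × firstPair t f′ g′ ≡ unordered (f′ i) (g′ i)
firstPair-index zero f g f′ g′ _ _ (Fin.zero , ne) = Fin.zero , ne , refl , refl
firstPair-index (suc t) f g f′ g′ to from (i , ne)
  with f Fin.zero Finₚ.≟ g Fin.zero | f′ Fin.zero Finₚ.≟ g′ Fin.zero | i
... | yes e | no ne′ | _ = ⊥-elim (ne′ (to Fin.zero e))
... | no ne | yes e′ | _ = ⊥-elim (ne (from Fin.zero e′))
... | no ne | no _   | _ = Fin.zero , ne , refl , refl
... | yes e | yes _  | Fin.zero = ⊥-elim (ne e)
... | yes _ | yes _  | Fin.suc i =
  let j , ne , e , e′ = firstPair-index t (f ∘ Fin.suc) (g ∘ Fin.suc) (f′ ∘ Fin.suc) (g′ ∘ Fin.suc)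
                (to ∘ Fin.suc) (from ∘ Fin.suc) (i , ne)
  in Fin.suc j , ne , e , e′

funToFin-cong : {f g : Fin s → Fin b} → (∀ i → f i ≡ g i) → funToFin f ≡ funToFin g
funToFin-cong {s = zero}  _  = refl
funToFin-cong {s = suc s} eq = cong₂ combine (eq Fin.zero) (funToFin-cong (eq ∘ Fin.suc))

-- Mubayi's colouring of the pairs in [b]ᵗ⁺¹: the set of coordinates in which
-- two vertices agree, and the unordered pair of entries at the first
-- coordinate in which they differ.
module Mubayi (b t : ℕ) where

  coordinates : Fin (b ^ suc t) → Fin (suc t) → Fin b
  coordinates = finToFun

  agreement : Fin (b ^ suc t) → Fin (b ^ suc t) → Fin (suc t) → Fin 2
  agreement x y i = bit (coordinates x i Finₚ.≟ coordinates y i)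

  c : Fin (b ^ suc t) → Fin (b ^ suc t) → Fin (2 ^ suc t * (b * b))
  c x y = combine (funToFin (agreement x y)) (firstPair t (coordinates x) (coordinates y))

  c-comm : ∀ x y → c x y ≡ c y x
  c-comm x y = cong₂ combine
    (funToFin-cong λ i → bit-cong
      (coordinates x i Finₚ.≟ coordinates y i) (coordinates y i Finₚ.≟ coordinates x i) sym sym)
    (firstPair-comm t (coordinates x) (coordinates y))

  c-agreement : ∀ {x y x′ y′} → c x y ≡ c x′ y′ →
    ∀ i → coordinates x i ≡ coordinates y i → coordinates x′ i ≡ coordinates y′ i
  c-agreement {x} {y} {x′} {y′} e i = bit-transfer
    (coordinates x i Finₚ.≟ coordinates y i) (coordinates x′ i Finₚ.≟ coordinates y′ i)
    (trans (sym (Finₚ.finToFun-funToFin (agreement x y) i))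
      (trans (cong (λ f → finToFun f i) (proj₁ (Finₚ.combine-injective _ _ _ _ e)))
               (Finₚ.finToFun-funToFin (agreement x′ y′) i)))

  differ : ∀ {x y} → x ≢ y → ∃[ i ] coordinates x i ≢ coordinates y i
  differ {x} {y} x≢y = Finₚ.¬∀⟶∃¬ (suc t) _ (λ i → coordinates x i Finₚ.≟ coordinates y i)
    λ eq → x≢y (trans (sym (Finₚ.funToFin-finToFin {suc t} {b} x))
      (trans (funToFin-cong eq) (Finₚ.funToFin-finToFin {suc t} {b} y)))

  -- If `c y z ≡ c x w`, then at the first coordinate `i` where `y` and `z` differ, the entry of `x`
  -- is that of `y` or that of `z`. But `c x y ≡ c x z` says that `x` agrees with `y` exactly where
  -- it agrees with `z`, so `y` and `z` would agree at `i`.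
  noHook : ∀ {x y z w} → y ≢ z → c x y ≡ c x z → c y z ≢ c x w
  noHook {x} {y} {z} {w} y≢z xy≡xz yz≡xw
    with i , yᵢ≢zᵢ , e , e′ ← firstPair-index t (coordinates y) (coordinates z) (coordinates x) (coordinates w)
                                 (c-agreement yz≡xw) (c-agreement (sym yz≡xw)) (differ y≢z)
    with unordered-injective (coordinates y i) (coordinates z i) (coordinates x i) (coordinates w i)
           (trans (sym e) (trans (proj₂ (Finₚ.combine-injective
             (funToFin (agreement y z)) _ (funToFin (agreement x w)) _ yz≡xw)) e′))
  ... | inj₁ xᵢ≡yᵢ = yᵢ≢zᵢ (trans (sym xᵢ≡yᵢ) (c-agreement xy≡xz i xᵢ≡yᵢ))
  ... | inj₂ xᵢ≡zᵢ = yᵢ≢zᵢ (trans (sym (c-agreement (sym xy≡xz) i xᵢ≡zᵢ)) xᵢ≡zᵢ)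

  -- The vertex `v` supplies a default colour.
  φ : Fin (b ^ suc t) → Subset (b ^ suc t) → Fin (2 ^ suc t * (b * b))
  φ v = pairColor c (c v v)

  φ-noHook : ∀ v → NoHook (φ v)
  φ-noHook v x y z w x≢y x≢z y≢z x≢w xy≡xz yz≡xw = noHook y≢z
    (trans (sym (φ-pair x≢y)) (trans xy≡xz (φ-pair x≢z)))
    (trans (sym (φ-pair y≢z)) (trans yz≡xw (φ-pair x≢w)))
    where
    φ-pair : ∀ {x y} → x ≢ y → φ v (pair x y) ≡ c x y
    φ-pair = pairColor-pair c (c v v) c-comm

-- Assembling the tower

restrict₁ : Colorable (suc n) k m → Colorable n k m
restrict₁ {n} {k} (φ , good) = φ ∘ (false ∷_) , record
  { two   = λ S e → mapTwo (tail S) (reflects S) (two (false ∷ S) e)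
  ; three = λ S e → mapThree (tail S) (reflects S) (three (false ∷ S) e) }
  where
  open Good good
  tail : ∀ S → Subsets (false ∷ S) k → Subsets S k
  tail S (_ ∷ E , b≤b ∷ le , e) = E , le , e
  reflects : ∀ S (E F : Subsets (false ∷ S) k) →
    φ (false ∷ proj₁ (tail S E)) ≡ φ (false ∷ proj₁ (tail S F)) → φ (proj₁ E) ≡ φ (proj₁ F)
  reflects S (_ ∷ _ , b≤b ∷ _ , _) (_ ∷ _ , b≤b ∷ _ , _) eq = eq

restrict : ∀ d → Colorable (d + n) k m → Colorable n k m
restrict zero    col = col
restrict (suc d) col = restrict d (restrict₁ col)

stepCost : ℕ → ℕ → ℕ
stepCost zero    k = 1
stepCost (suc j) k = stepCost j (suc k) * 3 ^ suc k

stepUp* : ∀ j → 3 ≤ k → Colorable n k m → Colorable (tower j n) (j + k) (stepCost j k * m)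
stepUp* {m = m} zero 3≤k col = subst (Colorable _ _) (sym (ℕₚ.+-identityʳ m)) col
stepUp* {k} {m = m} (suc j) 3≤k col =
  subst₂ (Colorable _) (ℕₚ.+-suc j k) (sym (ℕₚ.*-assoc (stepCost j (suc k)) (3 ^ suc k) m))
    (stepUp* j (ℕₚ.m≤n⇒m≤1+n 3≤k) (stepUp 3≤k col))

-- With `b = 2^(t + 1)` the graph colouring has `b^(t + 1) = 2^((t + 1)²)` vertices, which is the
-- first exponential over the top. Passing to triples is the second, at the cost of a factor
-- `27 = 3^3`, and `stepUp*` adds the other `j`. The graph colours number
-- `2^(t + 1) b² = 2^(3 (t + 1))`.
colorable : ∀ j t {n} → n ≤ tower (2 + j) (suc t * suc t) →
  Colorable n (j + 3) (stepCost j 3 * 27 * 2 ^ (3 * suc t))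
colorable j t {n} n≤ = restrict (tower (2 + j) (suc t * suc t) ∸ n)
  (subst (λ N → Colorable N (j + 3) (stepCost j 3 * 27 * 2 ^ (3 * suc t))) (sym (ℕₚ.m∸n+n≡m n≤))
  (subst₂ (λ N m → Colorable (tower (suc j) N) (j + 3) m)
    (trans (ℕₚ.^-*-assoc 2 (suc t) (suc t)) (sym (cube≡2^ (suc t * suc t))))
    (trans (cong (stepCost j 3 *_) (cong (27 *_) powers)) (sym (ℕₚ.*-assoc (stepCost j 3) 27 (2 ^ (3 * suc t)))))
    (stepUp* j ℕₚ.≤-refl (colorable₃ (φ v) (φ-noHook v)))))
  where
  open Mubayi (2 ^ suc t) t
  v : Fin ((2 ^ suc t) ^ suc t)
  v = fromℕ< (ℕₚ.m^n>0 (2 ^ suc t) {{ℕₚ.m^n≢0 2 (suc t)}} (suc t))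
  powers : 2 ^ suc t * (2 ^ suc t * 2 ^ suc t) ≡ 2 ^ (3 * suc t)
  powers = sym (trans (ℕₚ.^-distribˡ-+-* 2 (suc t) (suc t + (suc t + 0)))
    (cong (2 ^ suc t *_) (trans (ℕₚ.^-distribˡ-+-* 2 (suc t) (suc t + 0))
      (cong (λ u → 2 ^ suc t * 2 ^ u) (ℕₚ.+-identityʳ (suc t))))))

≤ˢ⇒⊆ : {E S : Subset n} → E ≤ˢ S → E ⊆ S
≤ˢ⇒⊆ (b≤b ∷ _)  here      = here
≤ˢ⇒⊆ (_ ∷ le)   (there i) = there (≤ˢ⇒⊆ le i)

isColoring : Colorable n k m → Σ[ col ∈ Coloring n k m ] Is[ k + 2 , 3 ]-Coloring col
isColoring {n} {k} {m} (φ , good) = φ ∘ proj₁ , λ S e →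
  let (X , p , eX) , (Y , q , eY) , (Z , s , eZ) , X≢Y , X≢Z , Y≢Z = three S (trans e (ℕₚ.+-comm k 2))
  in (λ { Fin.zero → φ X ; (Fin.suc Fin.zero) → φ Y ; (Fin.suc (Fin.suc Fin.zero)) → φ Z }) ,
     (λ { {Fin.zero} {Fin.zero} _ → refl
        ; {Fin.zero} {Fin.suc Fin.zero} eq → ⊥-elim (X≢Y eq)
        ; {Fin.zero} {Fin.suc (Fin.suc Fin.zero)} eq → ⊥-elim (X≢Z eq)
        ; {Fin.suc Fin.zero} {Fin.zero} eq → ⊥-elim (X≢Y (sym eq))
        ; {Fin.suc Fin.zero} {Fin.suc Fin.zero} _ → refl
        ; {Fin.suc Fin.zero} {Fin.suc (Fin.suc Fin.zero)} eq → ⊥-elim (Y≢Z eq)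
        ; {Fin.suc (Fin.suc Fin.zero)} {Fin.zero} eq → ⊥-elim (X≢Z (sym eq))
        ; {Fin.suc (Fin.suc Fin.zero)} {Fin.suc Fin.zero} eq → ⊥-elim (Y≢Z (sym eq))
        ; {Fin.suc (Fin.suc Fin.zero)} {Fin.suc (Fin.suc Fin.zero)} _ → refl }) ,
     λ { Fin.zero → (X , eX) , ≤ˢ⇒⊆ p , refl
       ; (Fin.suc Fin.zero) → (Y , eY) , ≤ˢ⇒⊆ q , refl
       ; (Fin.suc (Fin.suc Fin.zero)) → (Z , eZ) , ≤ˢ⇒⊆ s , refl }
  where open Good good

theorem1p2 : (k : ℕ) → 4 ≤ k →
    (∃[ C ] 0ℚ < C ×
    Eventually (λ n → ∀ m → IsF k n (k + 2) 3 m →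
    fromℕ m ≼ exp (C · √ (log₍ k ∸ 1 ₎ (fromℕ n)))))
    × (∀ C → 0ℚ < C → ∀ ε → 0ℚ < ε →
    Eventually (λ n →
    exp (C · √ (log₍ k ∸ 1 ₎ (fromℕ n))) ≼ (log₍ k ∸ 2 ₎ (fromℕ n)) ^ʳ ε))
theorem1p2 k@(suc (suc (suc j))) (s≤s (s≤s (s≤s 1≤j))) =
  -- Since `k = 3 + j`, the numbers of logarithms `k ∸ 1` and `k ∸ 2` reduce to `2 + j` and `1 + j`;
  -- the former is the height of the tower in `colorable`.
  expSqrtBound cost (2 + j) (λ n m → IsF k n (k + 2) 3 m) few , expSqrtNegligible (1 + j)
  where
  cost : ℕ
  cost = stepCost j 3 * 27
  few : ∀ t {n} → n ≤ tower (2 + j) (suc t * suc t) → ∀ m → IsF k n (k + 2) 3 m → m ≤ cost * 2 ^ (3 * suc t)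
  few t {n} n≤ m isF =
    let col , ok = isColoring (subst (λ k → Colorable n k (cost * 2 ^ (3 * suc t))) (ℕₚ.+-comm j 3) (colorable j t n≤))
    in IsF.minimal isF _ col ok
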